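{- Let $n \geq 3$ and let $C_n$ be the cycle on $n$ vertices. Then $C_n$ is not a geodesic Leech graph, except for $n = 3$ and $n = 4$; that is, $C_3$ and $C_4$ are geodesic Leech graphs, and $C_n$ is not a geodesic Leech graph for every $n \geq 5$.
   Context: All graphs are finite, simple and undirected. A geodesic path in a graph $G$ is a path with at least one edge which is a shortest path in $G$ between its two end vertices; paths are undirected (a path and its reversal are the same path). The geodesic path number $t_{gp}(G)$ is the total number of geodesic paths in $G$. For an edge labeling $f : E(G) \to \{1,2,3,\dots\}$, the weight of a path $P$ is $w(P) = \sum_{e \in E(P)} f(e)$. The labeling $f$ is a geodesic Leech labeling of $G$ if the set of weights of the $t_{gp}(G)$ geodesic paths in $G$ is $\{1,2,\dots,t_{gp}(G)\}$ (so each of these values is the weight of exactly one geodesic path). A graph which admits a geodesic Leech labeling is called a geodesic Leech graph. -}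

module Defs where

open import Data.Fin using (Fin; toℕ)
open import Data.List using (List; []; _∷_; reverse)
open import Data.List.Properties using (reverse-involutive)
open import Data.List.Relation.Unary.Unique.Propositional using (Unique)
open import Data.Nat using (ℕ; suc; _+_; _≤_; _≥_; _≟_; s≤s)
open import Data.Nat.Properties using (1+n≢n)
open import Data.Product using (_×_; _,_; ∃-syntax)
open import Data.Sum using (_⊎_; inj₁; inj₂; swap)
open import Function using (_⇔_; Bijection)
open import Level using (0ℓ)
open import Relation.Binary using (Rel; Symmetric; Decidable; Setoid; IsEquivalence)
open import Relation.Binary.Construct.Closure.ReflexiveTransitive using (Star; ε; _◅_)
open import Relation.Binary.PropositionalEquality
  using (_≡_; refl; sym; trans; cong; setoid)
open import Relation.Nullary using (¬_)
open import Relation.Nullary.Decidable using (_×-dec_; _⊎-dec_)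

record Graph : Set₁ where
  field
    order      : ℕ
  Vertex : Set
  Vertex = Fin order
  field
    Adj        : Rel Vertex 0ℓ
    adj-sym    : Symmetric Adj
    adj-irrefl : ∀ {v} → ¬ Adj v v
    adj?       : Decidable Adj

module _ (G : Graph) where
  open Graph G

  Walk : Rel Vertex 0ℓ
  Walk = Star Adj

  -- An edge is an unordered pair {u , v}: by `label-sym` (together with
  -- `adj-sym`) a label depends neither on the orientation of the edge nor on
  -- the proof of adjacency.
  record EdgeLabeling : Set where
    field
      label     : ∀ {u v} → Adj u v → ℕ
      label-pos : ∀ {u v} (e : Adj u v) → 1 ≤ label e
      label-sym : ∀ {u v} (e : Adj u v) (e′ : Adj v u) → label e ≡ label e′

  vertices : ∀ {u v} → Walk u v → List Vertex
  vertices {u} ε       = u ∷ []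
  vertices {u} (_ ◅ p) = u ∷ vertices p

  -- The number of edges.
  length : ∀ {u v} → Walk u v → ℕ
  length ε       = 0
  length (_ ◅ p) = suc (length p)

  IsPath : ∀ {u v} → Walk u v → Set
  IsPath p = Unique (vertices p)

  IsGeodesic : ∀ {u v} → Walk u v → Set
  IsGeodesic {u} {v} p =
    IsPath p × 1 ≤ length p × (∀ (q : Walk u v) → IsPath q → length p ≤ length q)

  weight : EdgeLabeling → ∀ {u v} → Walk u v → ℕ
  weight f ε       = 0
  weight f (e ◅ p) = EdgeLabeling.label f e + weight f p

  record GeodesicPath : Set where
    field
      {source target} : Vertex
      walk            : Walk source target
      isGeodesic      : IsGeodesic walk

  open GeodesicPath

  -- Paths are undirected: the two traversals of a path are identified.
  SamePath : Rel GeodesicPath 0ℓ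
  SamePath p q =
    vertices (walk p) ≡ vertices (walk q) ⊎ vertices (walk p) ≡ reverse (vertices (walk q))

  samePath-isEquivalence : IsEquivalence SamePath
  samePath-isEquivalence = record
    { refl  = inj₁ refl
    ; sym   = λ where
        (inj₁ e) → inj₁ (sym e)
        (inj₂ e) → inj₂ (flip-reverse e)
    ; trans = λ where
        (inj₁ e) (inj₁ e′) → inj₁ (trans e e′)
        (inj₁ e) (inj₂ e′) → inj₂ (trans e e′)
        (inj₂ e) (inj₁ e′) → inj₂ (trans e (cong reverse e′))
        (inj₂ e) (inj₂ e′) → inj₁ (trans e (sym (flip-reverse e′)))
    }
    where
    flip-reverse : ∀ {xs ys : List Vertex} → xs ≡ reverse ys → ys ≡ reverse xs
    flip-reverse {ys = ys} e = sym (trans (cong reverse e) (reverse-involutive ys))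

  geodesicPathSetoid : Setoid 0ℓ 0ℓ
  geodesicPathSetoid = record { isEquivalence = samePath-isEquivalence }

  -- t is the number t_gp(G) of geodesic paths, counted up to reversal.
  IsGeodesicPathNumber : ℕ → Set
  IsGeodesicPathNumber t = Bijection (setoid (Fin t)) geodesicPathSetoid

  -- The set of weights of geodesic paths is {1, …, t_gp(G)}.
  IsGeodesicLeechLabeling : EdgeLabeling → Set
  IsGeodesicLeechLabeling f =
    ∃[ t ] IsGeodesicPathNumber t
         × (∀ k → (∃[ p ] weight f (walk p) ≡ k) ⇔ (1 ≤ k × k ≤ t))

  IsGeodesicLeechGraph : Set
  IsGeodesicLeechGraph = ∃[ f ] IsGeodesicLeechLabeling f

-- j is the cyclic successor of i: j ≡ i + 1 (mod n).
Next : ∀ {n} → Rel (Fin n) 0ℓ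
Next {n} i j = toℕ j ≡ suc (toℕ i) ⊎ (suc (toℕ i) ≡ n × toℕ j ≡ 0)

-- The bound excludes the degenerate orders, for which there is no simple cycle.
cycle : (n : ℕ) → n ≥ 3 → Graph
cycle n n≥3 = record
  { order      = n
  ; Adj        = λ i j → Next i j ⊎ Next j i
  ; adj-sym    = swap
  ; adj-irrefl = λ where
      (inj₁ l) → next-irrefl n≥3 l
      (inj₂ l) → next-irrefl n≥3 l
  ; adj?       = λ i j → next? i j ⊎-dec next? j i
  }
  where
  next-irrefl : ∀ {m} → m ≥ 3 → {i : Fin m} → ¬ Next i i
  next-irrefl _ (inj₁ e) = 1+n≢n (sym e)
  next-irrefl (s≤s (s≤s _)) (inj₂ (e , z)) with () ← trans (sym e) (cong suc z)

  next? : ∀ {m} → Decidable (Next {m})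
  next? {m} i j = (toℕ j ≟ suc (toℕ i)) ⊎-dec ((suc (toℕ i) ≟ m) ×-dec (toℕ j ≟ 0))

{-# OPTIONS --safe #-}

-- Put k = ⌊ n / 2 ⌋.  The geodesics of C_n are the nk arcs of length 1, …, k.  Every edge lies on
-- l of the n arcs of length l, so if the weights of the arcs are 1, …, nk and t is the sum of all
-- labels, then t k (k + 1) / 2 = nk (nk + 1) / 2, that is, (k + 1) t = n (nk + 1).  For n = 2k + 1
-- this gives k + 1 ∣ 2 and for n = 2k it gives k + 1 ∣ 6, which leaves n = 10, t = 85.  There, two
-- complementary arcs have weights adding up to 85, so the weights of all the arcs within a window of
-- nine edges determine the weights of all fifty geodesics; some label is 1, and an exhaustive search
-- over the windows ending in the label 1 finds a repeated or excessive weight in each case.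

module Submission where

open import Defs
open import Data.Bool using (Bool; true; false; if_then_else_)
import Data.Bool as Bool
open import Data.Bool.ListAction using (all)
open import Data.Bool.Properties using (¬-not)
open import Data.Fin using (Fin; toℕ; fromℕ<; combine; remQuot)
open import Data.Fin.Properties
  using (toℕ-injective; toℕ-fromℕ<; toℕ<n; injective⇒≤; combine-remQuot; remQuot-combine)
import Data.Fin.Properties as Fin
open import Data.List
  using (List; []; _∷_; _++_; _ʳ++_; map; reverse; take; drop; upTo; applyUpTo; applyDownFrom; cartesianProduct)
import Data.List as List
open import Data.List.Membership.Propositional using (_∈_)
open import Data.List.Membership.Propositional.Properties
  using (∈-∃++; ∈-map⁺; ∈-map⁻; ∈-applyUpTo⁺; ∈-applyUpTo⁻; ∈-upTo⁺; ∈-cartesianProduct⁺)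
open import Data.List.Properties
  using (∷-injectiveˡ; ∷-injectiveʳ; length-applyUpTo; length-map; length-++; reverse-applyUpTo;
         reverse-applyDownFrom; map-applyUpTo; map-upTo; map-++; map-∘; map-cong; map-cong-local;
         take-map; drop-map)
open import Data.List.Relation.Binary.Permutation.Propositional
  using (_↭_; ↭-refl; ↭-sym; ↭-trans; ↭⇒↭ₛ; prep)
open import Data.List.Relation.Binary.Permutation.Propositional.Properties
  using (shift; ↭-length; ∈-resp-↭)
open import Data.List.Relation.Binary.Permutation.Setoid.Properties using (Unique-resp-↭)
open import Data.List.Relation.Unary.All as All using (All; []; _∷_)
import Data.List.Relation.Unary.All.Properties as All
open import Data.List.Relation.Unary.AllPairs using ([]; _∷_)
open import Data.List.Relation.Unary.Any using (here; there)
open import Data.List.Relation.Unary.Unique.DecPropositional using (unique?)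
open import Data.List.Relation.Unary.Unique.Propositional using (Unique)
open import Data.List.Relation.Unary.Unique.Propositional.Properties using (applyUpTo⁺₁)
open import Data.Maybe using (Maybe; just; nothing; maybe′)
open import Data.Nat
open import Data.Nat.DivMod
open import Data.Nat.Divisibility using (_∣_; _∣?_; ∣⇒≤; ∣m+n∣m⇒∣n; m∣m*n; divides)
open import Data.Nat.ListAction using (sum)
open import Data.Nat.ListAction.Properties using (sum-++; sum-↭)
open import Data.Nat.Properties
open import Data.Nat.Tactic.RingSolver using (solve-∀)
open import Data.Product using (_×_; _,_; proj₁; proj₂; ∃-syntax; Σ-syntax)
open import Data.Product.Properties using (≡-dec)
open import Data.Sum using (_⊎_; inj₁; inj₂)
open import Data.Vec using ([]; _∷_; lookup)
open import Function using (_∘_; Bijection; mk⇔; Equivalence)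
open import Relation.Binary using (IsEquivalence)
open import Relation.Binary.Construct.Closure.ReflexiveTransitive using (ε; _◅_)
open import Relation.Binary.PropositionalEquality
open import Relation.Nullary using (¬_; contradiction; yes; no)
open import Relation.Nullary.Decidable using (Dec; True; toWitness; from-yes; from-no; _×-dec_; _→-dec_)

-- The definition only asks that the set of weights be {1, ..., t}, where t comes with some
-- bijection onto the geodesics. Two facts must therefore be earned: t = nk, by matching geodesics
-- up to reversal with pairs of a start and a length, every arc being read clockwise; and that no
-- weight repeats, by pigeonhole, since nk arcs attain nk values. After that a labeling is just a
-- periodic sequence on ℕ, so that rotating the cycle is shifting an index.
--
-- Nine edges suffice for n = 10 because a geodesic through the tenth edge has a complement of at
-- least five edges that avoids it. The search is evaluated during type checking, which is why a set
-- of weights is a single number, tested and enlarged by one division, one remainder or one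
-- addition.

arcSum : (ℕ → ℕ) → ℕ → ℕ → ℕ
arcSum a i zero    = 0
arcSum a i (suc l) = a i + arcSum a (suc i) l

arcSum-snoc : ∀ a i l → arcSum a i (suc l) ≡ arcSum a i l + a (i + l)
arcSum-snoc a i zero    = trans (+-identityʳ (a i)) (cong a (sym (+-identityʳ i)))
arcSum-snoc a i (suc l) = begin
  a i + arcSum a (suc i) (suc l)              ≡⟨ cong (a i +_) (arcSum-snoc a (suc i) l) ⟩
  a i + (arcSum a (suc i) l + a (suc i + l))  ≡⟨ +-assoc (a i) _ _ ⟨
  arcSum a i (suc l) + a (suc (i + l))        ≡⟨ cong (λ j → arcSum a i (suc l) + a j) (+-suc i l) ⟨
  arcSum a i (suc l) + a (i + suc l)          ∎
  where open ≡-Reasoning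

-- The labels met when walking around the cycle for ever; k is the length of the longest geodesics.
record IsLeechSequence (n k : ℕ) (a : ℕ → ℕ) : Set where
  field
    periodic : ∀ i → a (n + i) ≡ a i
    positive : ∀ i → 1 ≤ a i
    complete : ∀ w → 1 ≤ w → w ≤ n * k → ∃[ i ] ∃[ l ] 1 ≤ l × l ≤ k × arcSum a i l ≡ w
    bounded  : ∀ i l → 1 ≤ l → l ≤ k → arcSum a i l ≤ n * k

-- Geodesics of the cycle

module CycleGeodesics (n k : ℕ) (n≥3 : n ≥ 3) (2k≤n : k + k ≤ n) (n≤1+2k : n ≤ suc (k + k)) where

  private instance
    n≢0 : NonZero n
    n≢0 = >-nonZero (≤-trans (s≤s z≤n) n≥3)

  C : Graph
  C = cycle n n≥3

  open Graph C
  open GeodesicPath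

  k<n : k < n
  k<n = ≰⇒> λ n≤k → contradiction
    (≤-trans (+-mono-≤ n≤k n≤k) 2k≤n) (<⇒≱ (m<m+n n (>-nonZero⁻¹ n)))

  ⟦_⟧ : ℕ → Vertex
  ⟦ i ⟧ = i mod n

  toℕ-⟦⟧ : ∀ i → toℕ ⟦ i ⟧ ≡ i % n
  toℕ-⟦⟧ i = toℕ-fromℕ< (m%n<n i n)

  ⟦⟧-toℕ : ∀ u → ⟦ toℕ u ⟧ ≡ u
  ⟦⟧-toℕ u = toℕ-injective (trans (toℕ-⟦⟧ (toℕ u)) (m<n⇒m%n≡m (toℕ<n u)))

  ⟦⟧-% : ∀ {i j} → i % n ≡ j % n → ⟦ i ⟧ ≡ ⟦ j ⟧
  ⟦⟧-% {i} {j} eq = toℕ-injective (trans (toℕ-⟦⟧ i) (trans eq (sym (toℕ-⟦⟧ j))))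

  %-⟦⟧ : ∀ {i j} → ⟦ i ⟧ ≡ ⟦ j ⟧ → i % n ≡ j % n
  %-⟦⟧ {i} {j} eq = trans (sym (toℕ-⟦⟧ i)) (trans (cong toℕ eq) (toℕ-⟦⟧ j))

  ⟦⟧-period : ∀ i → ⟦ n + i ⟧ ≡ ⟦ i ⟧
  ⟦⟧-period i = ⟦⟧-% (trans (cong (_% n) (+-comm n i)) ([m+n]%n≡m%n i n))

  ⟦⟧-+ : ∀ m {i j} → ⟦ i ⟧ ≡ ⟦ j ⟧ → ⟦ m + i ⟧ ≡ ⟦ m + j ⟧
  ⟦⟧-+ m {i} {j} eq = ⟦⟧-% (begin
    (m + i) % n            ≡⟨ %-distribˡ-+ m i n ⟩
    (m % n + i % n) % n    ≡⟨ cong (λ r → (m % n + r) % n) (%-⟦⟧ eq) ⟩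
    (m % n + j % n) % n    ≡⟨ %-distribˡ-+ m j n ⟨
    (m + j) % n            ∎)
    where open ≡-Reasoning

  -- Adding `pred n` completes a full turn and so undoes the successor modulo n.
  ⟦⟧-suc-injective : ∀ {i j} → ⟦ suc i ⟧ ≡ ⟦ suc j ⟧ → ⟦ i ⟧ ≡ ⟦ j ⟧
  ⟦⟧-suc-injective {i} {j} eq = begin
    ⟦ i ⟧               ≡⟨ ⟦⟧-period i ⟨
    ⟦ n + i ⟧           ≡⟨ cong ⟦_⟧ (pred-suc i) ⟨
    ⟦ pred n + suc i ⟧  ≡⟨ ⟦⟧-+ (pred n) eq ⟩
    ⟦ pred n + suc j ⟧  ≡⟨ cong ⟦_⟧ (pred-suc j) ⟩
    ⟦ n + j ⟧           ≡⟨ ⟦⟧-period j ⟩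
    ⟦ j ⟧               ∎
    where
    open ≡-Reasoning
    pred-suc : ∀ i → pred n + suc i ≡ n + i
    pred-suc i = trans (+-suc (pred n) i) (cong (_+ i) (suc-pred n))

  ⟦⟧-+-cancel : ∀ m {i j} → ⟦ m + i ⟧ ≡ ⟦ m + j ⟧ → ⟦ i ⟧ ≡ ⟦ j ⟧
  ⟦⟧-+-cancel zero    eq = eq
  ⟦⟧-+-cancel (suc m) eq = ⟦⟧-+-cancel m (⟦⟧-suc-injective eq)

  ⟦⟧-injective : ∀ {i j} → i < n → j < n → ⟦ i ⟧ ≡ ⟦ j ⟧ → i ≡ j
  ⟦⟧-injective i<n j<n eq = trans (sym (m<n⇒m%n≡m i<n)) (trans (%-⟦⟧ eq) (m<n⇒m%n≡m j<n))

  -- The source of every "too short to close up" argument: arcs repeat no vertex, no edge is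
  -- clockwise both ways, no walk is shorter than its arc.
  ⟦⟧-gap : ∀ i {d} → d < n → ⟦ i + d ⟧ ≡ ⟦ i ⟧ → d ≡ 0
  ⟦⟧-gap i d<n eq =
    ⟦⟧-injective d<n (>-nonZero⁻¹ n) (⟦⟧-+-cancel i (trans eq (cong ⟦_⟧ (sym (+-identityʳ i)))))

  next-⟦⟧ : ∀ i → Next ⟦ i ⟧ ⟦ suc i ⟧
  next-⟦⟧ i with suc (i % n) ≟ n
  ... | yes eq = inj₂ (trans (cong suc (toℕ-⟦⟧ i)) eq , (begin
      toℕ ⟦ suc i ⟧                        ≡⟨ cong toℕ (⟦⟧-+ 1 {i} {i % n} (⟦⟧-% (sym (m%n%n≡m%n i n)))) ⟩
      toℕ ⟦ suc (i % n) ⟧                  ≡⟨ cong (toℕ ∘ ⟦_⟧) eq ⟩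
      toℕ ⟦ n ⟧                            ≡⟨ toℕ-⟦⟧ n ⟩
      n % n                                ≡⟨ n%n≡0 n ⟩
      0                                    ∎))
    where open ≡-Reasoning
  ... | no neq = inj₁ (begin
      toℕ ⟦ suc i ⟧                        ≡⟨ cong toℕ (⟦⟧-+ 1 {i} {i % n} (⟦⟧-% (sym (m%n%n≡m%n i n)))) ⟩
      toℕ ⟦ suc (i % n) ⟧                  ≡⟨ toℕ-⟦⟧ (suc (i % n)) ⟩
      suc (i % n) % n                      ≡⟨ m<n⇒m%n≡m (≤∧≢⇒< (m%n<n i n) neq) ⟩
      suc (i % n)                          ≡⟨ cong suc (toℕ-⟦⟧ i) ⟨
      suc (toℕ ⟦ i ⟧)                      ∎)
    where open ≡-Reasoning

  next-functional : ∀ {u v w : Vertex} → Next u v → Next u w → v ≡ w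
  next-functional (inj₁ e) (inj₁ e′) = toℕ-injective (trans e (sym e′))
  next-functional {v = v} (inj₁ e) (inj₂ (e′ , _)) = contradiction (trans e e′) (<⇒≢ (toℕ<n v))
  next-functional {w = w} (inj₂ (e , _)) (inj₁ e′) = contradiction (trans e′ e) (<⇒≢ (toℕ<n w))
  next-functional (inj₂ (_ , e)) (inj₂ (_ , e′)) = toℕ-injective (trans e (sym e′))

  next⇒⟦⟧ : ∀ {u v : Vertex} {i} → Next u v → ⟦ i ⟧ ≡ u → ⟦ suc i ⟧ ≡ v
  next⇒⟦⟧ {i = i} e refl = next-functional (next-⟦⟧ i) e

  ⟦⟧⇒next : ∀ {u v : Vertex} {i} → ⟦ i ⟧ ≡ u → ⟦ suc i ⟧ ≡ v → Next u v
  ⟦⟧⇒next {i = i} refl refl = next-⟦⟧ i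

  next-injective : ∀ {u v w : Vertex} → Next u w → Next v w → u ≡ v
  next-injective {u} {v} e e′ = begin
    u            ≡⟨ ⟦⟧-toℕ u ⟨
    ⟦ toℕ u ⟧    ≡⟨ ⟦⟧-suc-injective (trans (next⇒⟦⟧ e (⟦⟧-toℕ u)) (sym (next⇒⟦⟧ e′ (⟦⟧-toℕ v)))) ⟩
    ⟦ toℕ v ⟧    ≡⟨ ⟦⟧-toℕ v ⟩
    v            ∎
    where open ≡-Reasoning

  -- Two clockwise steps back to the start would close a gap of 2, and 2 < n.
  next-asym : ∀ {u v : Vertex} → Next u v → ¬ Next v u
  next-asym {u} e e′ with () ← ⟦⟧-gap (toℕ u) {2} n≥3
    (trans (cong ⟦_⟧ (+-comm (toℕ u) 2)) (trans (next⇒⟦⟧ e′ (next⇒⟦⟧ e (⟦⟧-toℕ u))) (sym (⟦⟧-toℕ u))))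

  along : (g : ℕ → Vertex) → (∀ i → Adj (g i) (g (suc i))) → ∀ l → Walk C (g 0) (g l)
  along g e zero    = ε
  along g e (suc l) = e 0 ◅ along (g ∘ suc) (e ∘ suc) l

  vertices-along : ∀ g e l → vertices C (along g e l) ≡ applyUpTo g (suc l)
  vertices-along g e zero    = refl
  vertices-along g e (suc l) = cong (g 0 ∷_) (vertices-along (g ∘ suc) (e ∘ suc) l)

  length-along : ∀ g e l → length C (along g e l) ≡ l
  length-along g e zero    = refl
  length-along g e (suc l) = cong suc (length-along (g ∘ suc) (e ∘ suc) l)

  along-isPath : ∀ g e l → (∀ i {d} → d < n → g (i + d) ≡ g i → d ≡ 0) → l < n →
                 IsPath C (along g e l)
  along-isPath g e l gap l<n rewrite vertices-along g e l =
    applyUpTo⁺₁ g (suc l) λ {i} {j} i<j j≤l gi≡gj →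
      contradiction
        (gap i {j ∸ i} (≤-<-trans (m∸n≤m j i) (<-≤-trans j≤l l<n))
           (trans (cong g (m+[n∸m]≡n (<⇒≤ i<j))) (sym gi≡gj)))
        (m>n⇒m∸n≢0 i<j)

  clockwise : ℕ → ℕ → Vertex
  clockwise i j = ⟦ i + j ⟧

  clockwise-gap : ∀ i j {d} → d < n → clockwise i (j + d) ≡ clockwise i j → d ≡ 0
  clockwise-gap i j {d} d<n eq = ⟦⟧-gap (i + j) d<n (trans (cong ⟦_⟧ (+-assoc i j d)) eq)

  clockwise-next : ∀ i j → Next (clockwise i j) (clockwise i (suc j))
  clockwise-next i j = ⟦⟧⇒next refl (cong ⟦_⟧ (sym (+-suc i j)))

  -- A step back is a step by n - 1 modulo n, so no truncated subtraction occurs.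
  anticlockwise : ℕ → ℕ → Vertex
  anticlockwise i j = ⟦ i + j * pred n ⟧

  anticlockwise-return : ∀ i j → ⟦ j + (i + j * pred n) ⟧ ≡ ⟦ i ⟧
  anticlockwise-return i zero    = cong ⟦_⟧ (+-identityʳ i)
  anticlockwise-return i (suc j) = begin
    ⟦ suc j + (i + (pred n + j * pred n)) ⟧    ≡⟨ cong ⟦_⟧ (regroup i j (pred n) (j * pred n)) ⟩
    ⟦ suc (pred n) + (j + (i + j * pred n)) ⟧  ≡⟨ cong (λ m → ⟦ m + (j + (i + j * pred n)) ⟧) (suc-pred n) ⟩
    ⟦ n + (j + (i + j * pred n)) ⟧             ≡⟨ ⟦⟧-period _ ⟩
    ⟦ j + (i + j * pred n) ⟧                   ≡⟨ anticlockwise-return i j ⟩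
    ⟦ i ⟧                                      ∎
    where
    open ≡-Reasoning
    regroup : ∀ i j p q → suc j + (i + (p + q)) ≡ suc p + (j + (i + q))
    regroup = solve-∀

  anticlockwise-gap : ∀ i j {d} → d < n → anticlockwise i (j + d) ≡ anticlockwise i j → d ≡ 0
  anticlockwise-gap i j {d} d<n eq = ⟦⟧-gap i d<n (begin
    ⟦ i + d ⟧                                  ≡⟨ cong ⟦_⟧ (+-comm i d) ⟩
    ⟦ d + i ⟧                                  ≡⟨ ⟦⟧-+ d (anticlockwise-return i j) ⟨
    ⟦ d + (j + (i + j * pred n)) ⟧             ≡⟨ cong ⟦_⟧ (+-assoc d j _) ⟨
    ⟦ d + j + (i + j * pred n) ⟧               ≡⟨ ⟦⟧-+ (d + j) eq ⟨
    ⟦ d + j + (i + (j + d) * pred n) ⟧         ≡⟨ cong (λ m → ⟦ m + (i + (j + d) * pred n) ⟧) (+-comm d j) ⟩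
    ⟦ j + d + (i + (j + d) * pred n) ⟧         ≡⟨ anticlockwise-return i (j + d) ⟩
    ⟦ i ⟧                                      ∎)
    where open ≡-Reasoning

  anticlockwise-next : ∀ i j → Next (anticlockwise i (suc j)) (anticlockwise i j)
  anticlockwise-next i j = ⟦⟧⇒next refl (⟦⟧-+-cancel j (begin
    ⟦ j + suc (i + suc j * pred n) ⟧       ≡⟨ cong ⟦_⟧ (+-suc j _) ⟩
    ⟦ suc j + (i + suc j * pred n) ⟧       ≡⟨ anticlockwise-return i (suc j) ⟩
    ⟦ i ⟧                                  ≡⟨ anticlockwise-return i j ⟨
    ⟦ j + (i + j * pred n) ⟧               ∎))
    where open ≡-Reasoning

  -- Bounds geodesics by k: if the clockwise offset d exceeds k, the other way round takes n - d ≤ k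
  -- edges, because n ≤ 2k + 1.
  shortPath : ∀ u v → Σ[ q ∈ Walk C u v ] IsPath C q × length C q ≤ k
  shortPath u v = from-offset (m%n<n _ n) (trans (⟦⟧-% u+d%n) (⟦⟧-toℕ v))
    where
    d = (toℕ v + (n ∸ toℕ u)) % n

    u+d%n : (toℕ u + d) % n ≡ toℕ v % n
    u+d%n = begin
      (toℕ u + d) % n                                ≡⟨ %-⟦⟧ (⟦⟧-+ (toℕ u) (⟦⟧-% (m%n%n≡m%n _ n))) ⟩
      (toℕ u + (toℕ v + (n ∸ toℕ u))) % n            ≡⟨ cong (_% n) (regroup (toℕ u) (toℕ v) (n ∸ toℕ u)) ⟩
      (toℕ u + (n ∸ toℕ u) + toℕ v) % n              ≡⟨ cong (λ m → (m + toℕ v) % n) (m+[n∸m]≡n (<⇒≤ (toℕ<n u))) ⟩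
      (n + toℕ v) % n                                ≡⟨ %-⟦⟧ (⟦⟧-period (toℕ v)) ⟩
      toℕ v % n                                      ∎
      where
      open ≡-Reasoning
      regroup : ∀ x y z → x + (y + z) ≡ x + z + y
      regroup = solve-∀

    from-along : ∀ (g : ℕ → Vertex) (e : ∀ i → Adj (g i) (g (suc i))) l →
                 (∀ i {d} → d < n → g (i + d) ≡ g i → d ≡ 0) → l ≤ k →
                 g 0 ≡ u → g l ≡ v → Σ[ q ∈ Walk C u v ] IsPath C q × length C q ≤ k
    from-along g e l gap l≤k refl refl =
      along g e l , along-isPath g e l gap (≤-<-trans l≤k k<n) ,
      ≤-trans (≤-reflexive (length-along g e l)) l≤k

    from-offset : ∀ {d} → d < n → ⟦ toℕ u + d ⟧ ≡ v → Σ[ q ∈ Walk C u v ] IsPath C q × length C q ≤ k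
    from-offset {d} d<n eq with d ≤? k
    ... | yes d≤k = from-along (clockwise (toℕ u)) (λ j → inj₁ (clockwise-next (toℕ u) j)) d
      (clockwise-gap (toℕ u)) d≤k (trans (cong ⟦_⟧ (+-identityʳ (toℕ u))) (⟦⟧-toℕ u)) eq
    ... | no d≰k = from-along (anticlockwise (toℕ u)) (λ j → inj₂ (anticlockwise-next (toℕ u) j)) (n ∸ d)
      (anticlockwise-gap (toℕ u)) n∸d≤k (trans (cong ⟦_⟧ (+-identityʳ (toℕ u))) (⟦⟧-toℕ u))
      (trans (⟦⟧-+-cancel (n ∸ d) (begin
        ⟦ n ∸ d + anti ⟧              ≡⟨ anticlockwise-return (toℕ u) (n ∸ d) ⟩
        ⟦ toℕ u ⟧                     ≡⟨ ⟦⟧-period (toℕ u) ⟨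
        ⟦ n + toℕ u ⟧                 ≡⟨ cong (λ m → ⟦ m + toℕ u ⟧) (m∸n+n≡m (<⇒≤ d<n)) ⟨
        ⟦ n ∸ d + d + toℕ u ⟧         ≡⟨ cong ⟦_⟧ (trans (+-assoc (n ∸ d) d _) (cong (n ∸ d +_) (+-comm d _))) ⟩
        ⟦ n ∸ d + (toℕ u + d) ⟧       ∎)) eq)
      where
      open ≡-Reasoning
      anti = toℕ u + (n ∸ d) * pred n
      n∸d≤k : n ∸ d ≤ k
      n∸d≤k = m≤n+o⇒m∸n≤o n d (≤-trans n≤1+2k (+-monoˡ-≤ k (≰⇒> d≰k)))

  -- `x` and `y` count the clockwise and the anticlockwise steps; keeping both avoids a signed
  -- displacement.
  walk-displacement : ∀ {u v} (q : Walk C u v) →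
    ∃[ x ] ∃[ y ] x + y ≡ length C q × ⟦ toℕ v + y ⟧ ≡ ⟦ toℕ u + x ⟧
  walk-displacement ε = 0 , 0 , refl , refl
  walk-displacement {u} {v} (_◅_ {j = w} (inj₁ e) q) with walk-displacement q
  ... | x , y , x+y≡l , eq = suc x , y , cong suc x+y≡l , (begin
      ⟦ toℕ v + y ⟧        ≡⟨ eq ⟩
      ⟦ toℕ w + x ⟧        ≡⟨ cong ⟦_⟧ (+-comm (toℕ w) x) ⟩
      ⟦ x + toℕ w ⟧        ≡⟨ ⟦⟧-+ x (trans (⟦⟧-toℕ w) (sym (next⇒⟦⟧ e (⟦⟧-toℕ u)))) ⟩
      ⟦ x + suc (toℕ u) ⟧  ≡⟨ cong ⟦_⟧ (trans (+-comm x _) (sym (+-suc (toℕ u) x))) ⟩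
      ⟦ toℕ u + suc x ⟧    ∎)
    where open ≡-Reasoning
  walk-displacement {u} {v} (_◅_ {j = w} (inj₂ e) q) with walk-displacement q
  ... | x , y , x+y≡l , eq = x , suc y , trans (+-suc x y) (cong suc x+y≡l) , (begin
      ⟦ toℕ v + suc y ⟧    ≡⟨ cong ⟦_⟧ (+-suc (toℕ v) y) ⟩
      ⟦ 1 + (toℕ v + y) ⟧  ≡⟨ ⟦⟧-+ 1 eq ⟩
      ⟦ 1 + (toℕ w + x) ⟧  ≡⟨ cong (⟦_⟧ ∘ suc) (+-comm (toℕ w) x) ⟩
      ⟦ suc (x + toℕ w) ⟧  ≡⟨ cong ⟦_⟧ (+-suc x (toℕ w)) ⟨
      ⟦ x + suc (toℕ w) ⟧  ≡⟨ ⟦⟧-+ x (trans (next⇒⟦⟧ e (⟦⟧-toℕ w)) (sym (⟦⟧-toℕ u))) ⟩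
      ⟦ x + toℕ u ⟧        ≡⟨ cong ⟦_⟧ (+-comm x (toℕ u)) ⟩
      ⟦ toℕ u + x ⟧        ∎)
    where open ≡-Reasoning

  -- A shorter walk would have displacement x − y ≡ l with 0 < l + y − x < 2l ≤ n.
  length-lowerBound : ∀ i l → l ≤ k → (q : Walk C (clockwise i 0) (clockwise i l)) → l ≤ length C q
  length-lowerBound i l l≤k q with walk-displacement q
  ... | x , y , len , eq = ≮⇒≥ λ q<l →
      let x+y<l = subst (_< l) (sym len) q<l
          x<l = ≤-<-trans (m≤m+n x y) x+y<l
          x≤l+y = ≤-trans (<⇒≤ x<l) (m≤m+n l y)
          d<n = ≤-<-trans (m∸n≤m (l + y) x)
                 (<-≤-trans (+-monoʳ-< l (≤-<-trans (m≤n+m y x) x+y<l))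
                   (≤-trans (+-mono-≤ l≤k l≤k) 2k≤n))
      in contradiction
           (⟦⟧-gap (i + x) d<n (trans (cong ⟦_⟧ (trans (+-assoc i x _) (cong (i +_) (m+[n∸m]≡n x≤l+y)))) displaced))
           (m>n⇒m∸n≢0 (<-≤-trans x<l (m≤m+n l y)))
    where
    open ≡-Reasoning
    normalise : ∀ j z → ⟦ toℕ ⟦ j ⟧ + z ⟧ ≡ ⟦ j + z ⟧
    normalise j z = trans (cong ⟦_⟧ (+-comm _ z)) (trans (⟦⟧-+ z (⟦⟧-toℕ ⟦ j ⟧)) (cong ⟦_⟧ (+-comm z j)))
    displaced : ⟦ i + (l + y) ⟧ ≡ ⟦ i + x ⟧
    displaced = begin
      ⟦ i + (l + y) ⟧              ≡⟨ cong ⟦_⟧ (+-assoc i l y) ⟨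
      ⟦ i + l + y ⟧                ≡⟨ normalise (i + l) y ⟨
      ⟦ toℕ ⟦ i + l ⟧ + y ⟧        ≡⟨ eq ⟩
      ⟦ toℕ ⟦ i + 0 ⟧ + x ⟧        ≡⟨ normalise (i + 0) x ⟩
      ⟦ i + 0 + x ⟧                ≡⟨ cong (λ j → ⟦ j + x ⟧) (+-identityʳ i) ⟩
      ⟦ i + x ⟧                    ∎

  arcWalk : ∀ i l → Walk C (clockwise i 0) (clockwise i l)
  arcWalk i = along (clockwise i) (inj₁ ∘ clockwise-next i)

  arc : ∀ i l → 1 ≤ l → l ≤ k → GeodesicPath C
  arc i l 1≤l l≤k = record
    { walk       = arcWalk i l
    ; isGeodesic = along-isPath _ _ l (clockwise-gap i) (≤-<-trans l≤k k<n)
                 , ≤-trans 1≤l (≤-reflexive (sym len))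
                 , λ q _ → ≤-trans (≤-reflexive len) (length-lowerBound i l l≤k q)
    }
    where len = length-along (clockwise i) (inj₁ ∘ clockwise-next i) l

  vertices-arc : ∀ i l → vertices C (arcWalk i l) ≡ applyUpTo (clockwise i) (suc l)
  vertices-arc i = vertices-along _ _

  -- Every geodesic is an arc

  data Clockwise : ∀ {u v} → Walk C u v → Set where
    ε   : ∀ {u} → Clockwise {u} ε
    _◅_ : ∀ {u v w} (e : Next u v) {p : Walk C v w} → Clockwise p → Clockwise (inj₁ e ◅ p)

  data Anticlockwise : ∀ {u v} → Walk C u v → Set where
    ε   : ∀ {u} → Anticlockwise {u} ε
    _◅_ : ∀ {u v w} (e : Next v u) {p : Walk C v w} → Anticlockwise p → Anticlockwise (inj₂ e ◅ p)

  source∈vertices : ∀ {u v} (p : Walk C u v) → u ∈ vertices C p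
  source∈vertices ε       = here refl
  source∈vertices (_ ◅ _) = here refl

  -- A change of direction leads straight back to the vertex just left, which a path cannot revisit.
  path-monotone : ∀ {u v} (p : Walk C u v) → IsPath C p → Clockwise p ⊎ Anticlockwise p
  path-monotone ε _ = inj₁ ε
  path-monotone (inj₁ e ◅ p) (u∉p ∷ p!) with path-monotone p p!
  ... | inj₁ c        = inj₁ (e ◅ c)
  ... | inj₂ ε        = inj₁ (e ◅ ε)
  ... | inj₂ (_◅_ e′ {p = q} _) =
    contradiction (next-injective e e′) (All.lookup u∉p (there (source∈vertices q)))
  path-monotone (inj₂ e ◅ p) (u∉p ∷ p!) with path-monotone p p!
  ... | inj₂ c        = inj₂ (e ◅ c)
  ... | inj₁ ε        = inj₂ (e ◅ ε)
  ... | inj₁ (_◅_ e′ {p = q} _) =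
    contradiction (next-functional e e′) (All.lookup u∉p (there (source∈vertices q)))

  clockwise-vertices : ∀ {u v} {p : Walk C u v} → Clockwise p →
    ∀ (g : ℕ → Vertex) → (∀ j → Next (g j) (g (suc j))) → g 0 ≡ u →
    vertices C p ≡ applyUpTo g (suc (length C p))
  clockwise-vertices ε       g next refl = refl
  clockwise-vertices (e ◅ c) g next refl =
    cong (g 0 ∷_) (clockwise-vertices c (g ∘ suc) (next ∘ suc) (next-functional (next 0) e))

  anticlockwise-start : ∀ {u v} {p : Walk C u v} → Anticlockwise p →
    ∀ i → ⟦ i ⟧ ≡ v → ⟦ i + length C p ⟧ ≡ u
  anticlockwise-start ε i eq = trans (cong ⟦_⟧ (+-identityʳ i)) eq
  anticlockwise-start {p = _ ◅ p} (e ◅ c) i eq =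
    trans (cong ⟦_⟧ (+-suc i (length C p))) (next⇒⟦⟧ e (anticlockwise-start c i eq))

  anticlockwise-vertices : ∀ {u v} {p : Walk C u v} → Anticlockwise p →
    ∀ (g : ℕ → Vertex) → (∀ j → Next (g j) (g (suc j))) → g (length C p) ≡ u →
    vertices C p ≡ applyDownFrom g (suc (length C p))
  anticlockwise-vertices ε g next refl = refl
  anticlockwise-vertices {p = _ ◅ p} (e ◅ c) g next refl =
    cong (g (suc (length C p)) ∷_)
      (anticlockwise-vertices c g next (next-injective (next (length C p)) e))

  geodesic-length : ∀ (p : GeodesicPath C) → length C (walk p) ≤ k
  geodesic-length p with shortPath (source p) (target p)
  ... | q , q-path , q≤k = ≤-trans (proj₂ (proj₂ (isGeodesic p)) q q-path) q≤k

  -- p runs through the arc that starts at i, in one of its two directions.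
  Traces : ∀ {u v} → Walk C u v → ℕ → Set
  Traces {u} p i = Clockwise p × ⟦ i ⟧ ≡ u ⊎ Anticlockwise p × ⟦ i + length C p ⟧ ≡ u

  geodesic-traces : ∀ (p : GeodesicPath C) → ∃[ i ] i < n × Traces (walk p) i
  geodesic-traces p with path-monotone (walk p) (proj₁ (isGeodesic p))
  ... | inj₁ c = toℕ (source p) , toℕ<n _ , inj₁ (c , ⟦⟧-toℕ _)
  ... | inj₂ c = toℕ (target p) , toℕ<n _ , inj₂ (c , anticlockwise-start c _ (⟦⟧-toℕ _))

  traces⇒same : ∀ (p : GeodesicPath C) i l 1≤l l≤k → length C (walk p) ≡ l → Traces (walk p) i →
                SamePath C (arc i l 1≤l l≤k) p
  traces⇒same p i l _ _ refl (inj₁ (c , eq)) = inj₁ (trans (vertices-arc i l)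
    (sym (clockwise-vertices c (clockwise i) (clockwise-next i) (trans (cong ⟦_⟧ (+-identityʳ i)) eq))))
  traces⇒same p i l _ _ refl (inj₂ (c , eq)) = inj₂ (trans (vertices-arc i l) (sym (trans
    (cong reverse (anticlockwise-vertices c (clockwise i) (clockwise-next i) eq))
    (reverse-applyDownFrom (clockwise i) (suc l)))))

  -- Start and length can be read off the vertex list. An arc is never the reversal of an arc, since
  -- its first edge would then be clockwise both ways.
  arc-injective : ∀ i j l m 1≤l l≤k 1≤m m≤k → i < n → j < n →
    SamePath C (arc i l 1≤l l≤k) (arc j m 1≤m m≤k) → i ≡ j × l ≡ m
  arc-injective i j l m _ _ _ _ i<n j<n (inj₁ eq) =
    ⟦⟧-injective i<n j<n
      (subst₂ (λ x y → ⟦ x ⟧ ≡ ⟦ y ⟧) (+-identityʳ i) (+-identityʳ j) (∷-injectiveˡ same)) ,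
    suc-injective (trans (sym (length-applyUpTo (clockwise i) (suc l)))
      (trans (cong List.length same) (length-applyUpTo (clockwise j) (suc m))))
    where
    same : applyUpTo (clockwise i) (suc l) ≡ applyUpTo (clockwise j) (suc m)
    same = trans (sym (vertices-arc i l)) (trans eq (vertices-arc j m))
  arc-injective i j (suc l) (suc m) _ _ _ _ i<n j<n (inj₂ eq) = contradiction
    (subst₂ Next (∷-injectiveˡ same) (∷-injectiveˡ (∷-injectiveʳ same)) (clockwise-next i 0))
    (next-asym (clockwise-next j m))
    where
    same : applyUpTo (clockwise i) (suc (suc l)) ≡ applyDownFrom (clockwise j) (suc (suc m))
    same = trans (sym (vertices-arc i (suc l)))
      (trans eq (trans (cong reverse (vertices-arc j (suc m))) (reverse-applyUpTo (clockwise j) (suc (suc m)))))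

  arcOf : Fin n × Fin k → GeodesicPath C
  arcOf (i , l) = arc (toℕ i) (suc (toℕ l)) (s≤s z≤n) (toℕ<n l)

  arcOf-injective : ∀ x y → SamePath C (arcOf x) (arcOf y) → x ≡ y
  arcOf-injective (i , l) (j , m) same
    with arc-injective (toℕ i) (toℕ j) _ _ (s≤s z≤n) (toℕ<n l) (s≤s z≤n) (toℕ<n m) (toℕ<n i) (toℕ<n j) same
  ... | i≡j , l≡m = cong₂ _,_ (toℕ-injective i≡j) (toℕ-injective (suc-injective l≡m))

  arcOf-surjective : ∀ p → ∃[ x ] SamePath C (arcOf x) p ×
    Traces (walk p) (toℕ (proj₁ x)) × length C (walk p) ≡ suc (toℕ (proj₂ x))
  arcOf-surjective p with geodesic-traces p
  ... | i , i<n , tr = x , traces⇒same p (toℕ (proj₁ x)) _ (s≤s z≤n) (toℕ<n (proj₂ x)) len tr′ , tr′ , len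
    where
    len-1 = pred (length C (walk p))
    suc-len-1 : suc len-1 ≡ length C (walk p)
    suc-len-1 = suc-pred _ {{>-nonZero (proj₁ (proj₂ (isGeodesic p)))}}
    len<k : len-1 < k
    len<k = ≤-trans (≤-reflexive suc-len-1) (geodesic-length p)
    x = fromℕ< i<n , fromℕ< len<k
    len : length C (walk p) ≡ suc (toℕ (proj₂ x))
    len = sym (trans (cong suc (toℕ-fromℕ< len<k)) suc-len-1)
    tr′ : Traces (walk p) (toℕ (proj₁ x))
    tr′ = subst (Traces (walk p)) (sym (toℕ-fromℕ< i<n)) tr

  geodesicPathNumber : IsGeodesicPathNumber C (n * k)
  geodesicPathNumber = record
    { to        = arcOf ∘ remQuot k
    ; cong      = λ { refl → inj₁ refl }
    ; bijective = (λ {x} {y} same → remQuot-injective x y (arcOf-injective (remQuot k x) (remQuot k y) same))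
                , λ p → let (i , l) , same , _ = arcOf-surjective p in
                    combine i l , λ { refl → subst (λ x → SamePath C (arcOf x) p) (sym (remQuot-combine i l)) same }
    }
    where
    remQuot-injective : ∀ (x y : Fin (n * k)) → remQuot {n} k x ≡ remQuot k y → x ≡ y
    remQuot-injective x y eq = trans (sym (combine-remQuot {n} k x))
      (trans (cong (λ (i , l) → combine i l) eq) (combine-remQuot {n} k y))

  -- Identifies the t supplied with a Leech labeling as nk: sending an index to its preimage under
  -- the other bijection is injective.
  geodesicPathNumber-unique : ∀ {t t′} → IsGeodesicPathNumber C t → IsGeodesicPathNumber C t′ → t ≡ t′
  geodesicPathNumber-unique b b′ = ≤-antisym (≤-by b b′) (≤-by b′ b)
    where
    open IsEquivalence (samePath-isEquivalence C) renaming (trans to ≈-trans; sym to ≈-sym) using ()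
    ≤-by : ∀ {s t} → IsGeodesicPathNumber C s → IsGeodesicPathNumber C t → s ≤ t
    ≤-by b b′ = injective⇒≤ {f = proj₁ ∘ B′.surjective ∘ B.to} λ {x} {y} eq →
      let x′ , to-x′ = B′.surjective (B.to x)
          y′ , to-y′ = B′.surjective (B.to y)
      in B.injective (≈-trans {B.to x} {B′.to x′} {B.to y} (≈-sym {B′.to x′} {B.to x} (to-x′ refl)) (to-y′ eq))
      where module B = Bijection b
            module B′ = Bijection b′

  -- Weights of geodesics as sums of consecutive labels

  module _ (f : EdgeLabeling C) where
    open EdgeLabeling f

    labels : ℕ → ℕ
    labels i = label {⟦ i ⟧} {⟦ suc i ⟧} (inj₁ (next-⟦⟧ i))

    -- `label-sym` only compares opposite orientations, so two proofs of the same adjacency are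
    -- compared through the reversed edge.
    label-irrelevant : ∀ {u v u′ v′} (e : Adj u v) (e′ : Adj u′ v′) → u ≡ u′ → v ≡ v′ → label e ≡ label e′
    label-irrelevant e e′ refl refl = trans (label-sym e (adj-sym e′)) (label-sym (adj-sym e′) e′)

    labels-next : ∀ {u v} (e : Next u v) i → ⟦ i ⟧ ≡ u → label {u} {v} (inj₁ e) ≡ labels i
    labels-next e i eq = label-irrelevant _ _ (sym eq) (sym (next⇒⟦⟧ e eq))

    clockwise-weight : ∀ {u v} {p : Walk C u v} → Clockwise p → ∀ i → ⟦ i ⟧ ≡ u →
      weight C f p ≡ arcSum labels i (length C p)
    clockwise-weight ε       i eq = refl
    clockwise-weight (e ◅ c) i eq =
      cong₂ _+_ (labels-next e i eq) (clockwise-weight c (suc i) (next⇒⟦⟧ e eq))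

    -- The first edge walked is the last edge of the clockwise arc, hence the use of `arcSum-snoc`.
    anticlockwise-weight : ∀ {u v} {p : Walk C u v} → Anticlockwise p → ∀ i → ⟦ i + length C p ⟧ ≡ u →
      weight C f p ≡ arcSum labels i (length C p)
    anticlockwise-weight ε i eq = refl
    anticlockwise-weight {u} {p = _ ◅ p} (e ◅ c) i eq = begin
      label (inj₂ e) + weight C f p                            ≡⟨ +-comm _ (weight C f p) ⟩
      weight C f p + label (inj₂ e)                            ≡⟨ cong₂ _+_ (anticlockwise-weight c i eq′)
                                                                    (trans (label-sym (inj₂ e) (inj₁ e)) (labels-next e _ eq′)) ⟩
      arcSum labels i (length C p) + labels (i + length C p)   ≡⟨ arcSum-snoc labels i (length C p) ⟨
      arcSum labels i (suc (length C p))                       ∎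
      where
      open ≡-Reasoning
      eq′ : ⟦ i + length C p ⟧ ≡ _
      eq′ = next-injective
        (⟦⟧⇒next refl (trans (cong ⟦_⟧ (sym (+-suc i (length C p)))) eq)) e

    traces⇒weight : ∀ {u v} {p : Walk C u v} i → Traces p i → weight C f p ≡ arcSum labels i (length C p)
    traces⇒weight i (inj₁ (c , eq)) = clockwise-weight c i eq
    traces⇒weight i (inj₂ (c , eq)) = anticlockwise-weight c i eq

    arc-clockwise : ∀ (g : ℕ → Vertex) (next : ∀ j → Next (g j) (g (suc j))) l → Clockwise (along g (inj₁ ∘ next) l)
    arc-clockwise g next zero    = ε
    arc-clockwise g next (suc l) = next 0 ◅ arc-clockwise (g ∘ suc) (next ∘ suc) l

    weight-arc : ∀ i l → weight C f (arcWalk i l) ≡ arcSum labels i l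
    weight-arc i l = trans
      (clockwise-weight (arc-clockwise (clockwise i) (clockwise-next i) l) i (cong ⟦_⟧ (sym (+-identityʳ i))))
      (cong (arcSum labels i) (length-along (clockwise i) (inj₁ ∘ clockwise-next i) l))

    weight-geodesic : ∀ p → ∃[ i ] ∃[ l ] weight C f (walk p) ≡ arcSum labels (toℕ {n} i) (suc (toℕ {k} l))
    weight-geodesic p with arcOf-surjective p
    ... | (i , l) , _ , tr , len = i , l ,
      trans (traces⇒weight (toℕ i) tr) (cong (arcSum labels (toℕ i)) len)

    leech⇒sequence : IsGeodesicLeechLabeling C f → IsLeechSequence n k labels
    leech⇒sequence (t , number , weights) = record
      { periodic = λ i → label-irrelevant _ _ (⟦⟧-period i)
          (trans (cong ⟦_⟧ (sym (+-suc n i))) (⟦⟧-period (suc i)))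
      ; positive = λ i → label-pos _
      ; complete = λ w 1≤w w≤nk →
          let p , wp = Equivalence.from (weights w) (1≤w , subst (w ≤_) (sym t≡nk) w≤nk)
              i , l , eq = weight-geodesic p
          in toℕ i , suc (toℕ l) , s≤s z≤n , toℕ<n l , trans (sym eq) wp
      ; bounded  = λ i l 1≤l l≤k → subst (_ ≤_) t≡nk
          (proj₂ (Equivalence.to (weights _) (arc i l 1≤l l≤k , weight-arc i l)))
      }
      where
      t≡nk = geodesicPathNumber-unique number geodesicPathNumber

    -- The hypotheses range over finite types so that they can be decided by evaluation for small
    -- cycles.
    sequence⇒leech :
      (∀ i l → arcSum labels (toℕ {n} i) (suc (toℕ {k} l)) ≤ n * k) →
      (∀ (w : Fin (n * k)) → ∃[ i ] ∃[ l ] arcSum labels (toℕ {n} i) (suc (toℕ {k} l)) ≡ suc (toℕ w)) →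
      IsGeodesicLeechLabeling C f
    sequence⇒leech bounded complete = n * k , geodesicPathNumber , λ w → mk⇔
      (λ (p , wp) → let i , l , eq = weight-geodesic p in
         subst (λ x → 1 ≤ x × x ≤ n * k) (trans (sym eq) wp)
           (≤-trans (label-pos _) (m≤m+n _ _) , bounded i l))
      (attained w)
      where
      attained : ∀ w → 1 ≤ w × w ≤ n * k → ∃[ p ] weight C f (walk p) ≡ w
      attained (suc w) (_ , w<nk) = let i , l , eq = complete (fromℕ< w<nk) in
        arcOf (i , l) , trans (weight-arc (toℕ i) (suc (toℕ l))) (trans eq (cong suc (toℕ-fromℕ< w<nk)))

-- Double counting

module _ {A : Set} where

  -- The pigeonhole step: with 1, ..., nk as `xs` and the weights of the nk arcs as `ys`, it shows
  -- that no weight repeats.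
  unique-⊆⇒↭ : {xs ys : List A} → Unique xs → (∀ {x} → x ∈ xs → x ∈ ys) →
               List.length ys ≤ List.length xs → xs ↭ ys
  unique-⊆⇒↭ {[]}     {[]} _ _ _ = ↭-refl
  unique-⊆⇒↭ {x ∷ xs} {ys} (x∉xs ∷ xs!) xs⊆ys len with ∈-∃++ (xs⊆ys (here refl))
  ... | as , bs , refl = ↭-trans (prep x (unique-⊆⇒↭ xs! xs⊆ len′)) (↭-sym (shift x as bs))
    where
    xs⊆ : ∀ {y} → y ∈ xs → y ∈ as ++ bs
    xs⊆ y∈xs with ∈-resp-↭ (shift x as bs) (xs⊆ys (there y∈xs))
    ... | here refl = contradiction refl (All.lookup x∉xs y∈xs)
    ... | there y∈  = y∈
    len′ : List.length (as ++ bs) ≤ List.length xs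
    len′ = s≤s⁻¹ (≤-trans (≤-reflexive (sym (↭-length (shift x as bs)))) len)

  unique-map⇒injective : {B : Set} (f : A → B) {xs : List A} → Unique (map f xs) →
    ∀ {x y} → x ∈ xs → y ∈ xs → f x ≡ f y → x ≡ y
  unique-map⇒injective f _ (here refl) (here refl) _ = refl
  unique-map⇒injective f (x∉ ∷ _) (here refl) (there y∈) eq = contradiction eq (All.lookup x∉ (∈-map⁺ f y∈))
  unique-map⇒injective f (y∉ ∷ _) (there x∈) (here refl) eq = contradiction (sym eq) (All.lookup y∉ (∈-map⁺ f x∈))
  unique-map⇒injective f (_ ∷ u) (there x∈) (there y∈) eq = unique-map⇒injective f u x∈ y∈ eq

  length-cartesianProduct : {B : Set} (xs : List A) (ys : List B) →
    List.length (cartesianProduct xs ys) ≡ List.length xs * List.length ys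
  length-cartesianProduct []       ys = refl
  length-cartesianProduct (x ∷ xs) ys = trans (length-++ (map (x ,_) ys))
    (cong₂ _+_ (length-map (x ,_) ys) (length-cartesianProduct xs ys))

  sum-cartesianProduct : {B : Set} (f : A × B → ℕ) (xs : List A) (ys : List B) →
    sum (map f (cartesianProduct xs ys)) ≡ sum (map (λ x → sum (map (λ y → f (x , y)) ys)) xs)
  sum-cartesianProduct f []       ys = refl
  sum-cartesianProduct f (x ∷ xs) ys = begin
    sum (map f (map (x ,_) ys ++ cartesianProduct xs ys))
      ≡⟨ cong sum (map-++ f (map (x ,_) ys) _) ⟩
    sum (map f (map (x ,_) ys) ++ map f (cartesianProduct xs ys))
      ≡⟨ sum-++ (map f (map (x ,_) ys)) _ ⟩
    sum (map f (map (x ,_) ys)) + sum (map f (cartesianProduct xs ys))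
      ≡⟨ cong₂ _+_ (cong sum (sym (map-∘ ys))) (sum-cartesianProduct f xs ys) ⟩
    sum (map (λ y → f (x , y)) ys) + sum (map (λ x → sum (map (λ y → f (x , y)) ys)) xs) ∎
    where open ≡-Reasoning

arcSum-shift : ∀ f i n → arcSum (f ∘ suc) i n ≡ arcSum f (suc i) n
arcSum-shift f i zero    = refl
arcSum-shift f i (suc n) = cong (f (suc i) +_) (arcSum-shift f (suc i) n)

arcSum-zero : ∀ i n → arcSum (λ _ → 0) i n ≡ 0
arcSum-zero i zero    = refl
arcSum-zero i (suc n) = arcSum-zero (suc i) n

arcSum-+ : ∀ f g i n → arcSum (λ j → f j + g j) i n ≡ arcSum f i n + arcSum g i n
arcSum-+ f g i zero    = refl
arcSum-+ f g i (suc n) = trans (cong (f i + g i +_) (arcSum-+ f g (suc i) n))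
  (interchange (f i) (g i) (arcSum f (suc i) n) (arcSum g (suc i) n))
  where
  interchange : ∀ a b c d → a + b + (c + d) ≡ a + c + (b + d)
  interchange = solve-∀

arcSum-* : ∀ f c i n → arcSum (λ j → f j * c) i n ≡ arcSum f i n * c
arcSum-* f c i zero    = refl
arcSum-* f c i (suc n) = trans (cong (f i * c +_) (arcSum-* f c (suc i) n)) (sym (*-distribʳ-+ c (f i) _))

arcSum-split : ∀ f i m n → arcSum f i (m + n) ≡ arcSum f i m + arcSum f (i + m) n
arcSum-split f i zero    n = cong (λ j → arcSum f j n) (sym (+-identityʳ i))
arcSum-split f i (suc m) n = trans (cong (f i +_) (arcSum-split f (suc i) m n))
  (trans (sym (+-assoc (f i) _ _)) (cong (λ j → arcSum f i (suc m) + arcSum f j n) (sym (+-suc i m))))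

sum-applyUpTo : ∀ f n → sum (applyUpTo f n) ≡ arcSum f 0 n
sum-applyUpTo f zero    = refl
sum-applyUpTo f (suc n) = cong (f 0 +_) (trans (sum-applyUpTo (f ∘ suc) n) (arcSum-shift f 0 n))

-- The arithmetic series from i + 1 to i + n, doubled to avoid a division; the free `i` carries the
-- induction.
double-arcSum-suc : ∀ i n → 2 * arcSum suc i n ≡ n * (2 * i + suc n)
double-arcSum-suc i zero    = refl
double-arcSum-suc i (suc n) = begin
  2 * (suc i + arcSum suc (suc i) n)      ≡⟨ *-distribˡ-+ 2 (suc i) _ ⟩
  2 * suc i + 2 * arcSum suc (suc i) n    ≡⟨ cong (2 * suc i +_) (double-arcSum-suc (suc i) n) ⟩
  2 * suc i + n * (2 * suc i + suc n)     ≡⟨ ring i n ⟩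
  suc n * (2 * i + suc (suc n))           ∎
  where
  open ≡-Reasoning
  ring : ∀ i n → 2 * suc i + n * (2 * suc i + suc n) ≡ suc n * (2 * i + suc (suc n))
  ring = solve-∀

-- Moving the start from i to i + 1 trades `f i` for `f (i + n)`, which are equal.
arcSum-rotate : ∀ n f → (∀ i → f (n + i) ≡ f i) → ∀ i → arcSum f i n ≡ arcSum f 0 n
arcSum-rotate n f periodic zero    = refl
arcSum-rotate n f periodic (suc i) = trans (+-cancelˡ-≡ (f i) _ _ (begin
  f i + arcSum f (suc i) n     ≡⟨ arcSum-snoc f i n ⟩
  arcSum f i n + f (i + n)     ≡⟨ cong (arcSum f i n +_) (trans (cong f (+-comm i n)) (periodic i)) ⟩
  arcSum f i n + f i           ≡⟨ +-comm _ (f i) ⟩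
  f i + arcSum f i n           ∎)) (arcSum-rotate n f periodic i)
  where open ≡-Reasoning

arcSum-periodic : ∀ n f → (∀ i → f (n + i) ≡ f i) → ∀ i l → arcSum f (n + i) l ≡ arcSum f i l
arcSum-periodic n f periodic i zero    = refl
arcSum-periodic n f periodic i (suc l) = cong₂ _+_ (periodic i)
  (trans (cong (λ j → arcSum f j l) (sym (+-suc n i))) (arcSum-periodic n f periodic (suc i) l))

arcSum-multiple : ∀ n f → (∀ i → f (n + i) ≡ f i) → ∀ q i l → arcSum f (i + q * n) l ≡ arcSum f i l
arcSum-multiple n f periodic zero    i l = cong (λ j → arcSum f j l) (+-identityʳ i)
arcSum-multiple n f periodic (suc q) i l = begin
  arcSum f (i + (n + q * n)) l   ≡⟨ cong (λ j → arcSum f j l) (regroup i n (q * n)) ⟩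
  arcSum f (n + (i + q * n)) l   ≡⟨ arcSum-periodic n f periodic (i + q * n) l ⟩
  arcSum f (i + q * n) l         ≡⟨ arcSum-multiple n f periodic q i l ⟩
  arcSum f i l                   ∎
  where
  open ≡-Reasoning
  regroup : ∀ i n m → i + (n + m) ≡ n + (i + m)
  regroup = solve-∀

-- The double count: without their first edges, the arcs of length l + 1 become the arcs of length
-- l, and those first edges run once round the cycle.
sum-arcSum : ∀ n f → (∀ i → f (n + i) ≡ f i) → ∀ l → arcSum (λ i → arcSum f i l) 0 n ≡ l * arcSum f 0 n
sum-arcSum n f periodic zero    = arcSum-zero 0 n
sum-arcSum n f periodic (suc l) = trans (arcSum-+ f (λ i → arcSum f (suc i) l) 0 n) (cong (arcSum f 0 n +_) (begin
  arcSum (λ i → arcSum f (suc i) l) 0 n    ≡⟨ arcSum-shift (λ i → arcSum f i l) 0 n ⟩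
  arcSum (λ i → arcSum f i l) 1 n          ≡⟨ arcSum-rotate n (λ i → arcSum f i l) (λ i → arcSum-periodic n f periodic i l) 1 ⟩
  arcSum (λ i → arcSum f i l) 0 n          ≡⟨ sum-arcSum n f periodic l ⟩
  l * arcSum f 0 n                         ∎))
  where open ≡-Reasoning

module LeechSequence {n k : ℕ} .{{_ : NonZero n}} {a : ℕ → ℕ} (leech : IsLeechSequence n k a) where
  open IsLeechSequence leech

  total : ℕ
  total = arcSum a 0 n

  -- Lengths come first, so that the sum of all weights splits by length into multiples of `total`.
  arcs : List (ℕ × ℕ)
  arcs = cartesianProduct (applyUpTo suc k) (upTo n)

  arcWeight : ℕ × ℕ → ℕ
  arcWeight (l , i) = arcSum a i l

  ∈-arcs : ∀ {l i} → 1 ≤ l → l ≤ k → i < n → (l , i) ∈ arcs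
  ∈-arcs {suc l} _ l<k i<n = ∈-cartesianProduct⁺ (∈-applyUpTo⁺ suc l<k) (∈-upTo⁺ i<n)

  weights-attained : ∀ {w} → w ∈ applyUpTo suc (n * k) → w ∈ map arcWeight arcs
  weights-attained w∈ with ∈-applyUpTo⁻ suc w∈
  ... | _ , w<nk , refl with complete _ (s≤s z≤n) w<nk
  -- The start may be any natural number; periodicity reduces it modulo n.
  ... | i , l , 1≤l , l≤k , eq = subst (_∈ map arcWeight arcs)
    (trans (trans (sym (arcSum-multiple n a periodic (i / n) (i % n) l))
      (cong (λ j → arcSum a j l) (sym (m≡m%n+[m/n]*n i n)))) eq)
    (∈-map⁺ arcWeight (∈-arcs 1≤l l≤k (m%n<n i n)))

  weights-↭ : applyUpTo suc (n * k) ↭ map arcWeight arcs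
  weights-↭ = unique-⊆⇒↭ (applyUpTo⁺₁ suc (n * k) (λ i<j _ → <⇒≢ i<j ∘ suc-injective)) weights-attained
    (≤-reflexive (begin
      List.length (map arcWeight arcs)                         ≡⟨ length-map arcWeight arcs ⟩
      List.length arcs                                         ≡⟨ length-cartesianProduct (applyUpTo suc k) (upTo n) ⟩
      List.length (applyUpTo suc k) * List.length (upTo n)     ≡⟨ cong₂ _*_ (length-applyUpTo suc k) (length-applyUpTo (λ i → i) n) ⟩
      k * n                                                    ≡⟨ *-comm k n ⟩
      n * k                                                    ≡⟨ length-applyUpTo suc (n * k) ⟨
      List.length (applyUpTo suc (n * k))                      ∎))
    where open ≡-Reasoning

  arcWeight-injective : ∀ {x y} → x ∈ arcs → y ∈ arcs → arcWeight x ≡ arcWeight y → x ≡ y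
  arcWeight-injective = unique-map⇒injective arcWeight
    (Unique-resp-↭ (setoid ℕ) (↭⇒↭ₛ weights-↭)
      (applyUpTo⁺₁ suc (n * k) (λ i<j _ → <⇒≢ i<j ∘ suc-injective)))

  total-equation : k * suc k * total ≡ n * k * suc (n * k)
  total-equation = begin
    k * suc k * total                                                  ≡⟨ cong (_* total) (double-arcSum-suc 0 k) ⟨
    2 * arcSum suc 0 k * total                                         ≡⟨ *-assoc 2 (arcSum suc 0 k) total ⟩
    2 * (arcSum suc 0 k * total)                                       ≡⟨ cong (2 *_) (arcSum-* suc total 0 k) ⟨
    2 * arcSum (λ l → suc l * total) 0 k                               ≡⟨ cong (2 *_) (sum-applyUpTo (λ l → suc l * total) k) ⟨
    2 * sum (applyUpTo (λ l → suc l * total) k)                        ≡⟨ cong ((2 *_) ∘ sum) (map-applyUpTo suc (_* total) k) ⟨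
    2 * sum (map (_* total) (applyUpTo suc k))                         ≡⟨ cong ((2 *_) ∘ sum) (map-cong′ (applyUpTo suc k)) ⟨
    2 * sum (map (λ l → sum (map (λ i → arcSum a i l) (upTo n))) (applyUpTo suc k))
                                                                       ≡⟨ cong (2 *_) (sum-cartesianProduct arcWeight (applyUpTo suc k) (upTo n)) ⟨
    2 * sum (map arcWeight arcs)                                       ≡⟨ cong (2 *_) (sum-↭ weights-↭) ⟨
    2 * sum (applyUpTo suc (n * k))                                    ≡⟨ cong (2 *_) (sum-applyUpTo suc (n * k)) ⟩
    2 * arcSum suc 0 (n * k)                                           ≡⟨ double-arcSum-suc 0 (n * k) ⟩
    n * k * suc (n * k)                                                ∎
    where
    open ≡-Reasoning
    map-cong′ : ∀ ls → map (λ l → sum (map (λ i → arcSum a i l) (upTo n))) ls ≡ map (_* total) ls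
    map-cong′ = map-cong λ l → trans (cong sum (map-upTo (λ i → arcSum a i l) n))
      (trans (sum-applyUpTo (λ i → arcSum a i l) n) (sum-arcSum n a periodic l))

-- Divisibility constraints on k

halve : ∀ n → ∃[ k ] (n ≡ k + k ⊎ n ≡ suc (k + k))
halve zero    = 0 , inj₁ refl
halve (suc n) with halve n
... | k , inj₁ refl = k , inj₂ refl
... | k , inj₂ refl = suc k , inj₁ (cong suc (sym (+-suc k k)))

total-equation-cancel : ∀ n k {t} → k * suc k * t ≡ n * k * suc (n * k) → 1 ≤ k → suc k * t ≡ n * suc (n * k)
total-equation-cancel n k {t} eq 1≤k = *-cancelˡ-≡ _ _ k {{>-nonZero 1≤k}} (begin
  k * (suc k * t)        ≡⟨ *-assoc k (suc k) t ⟨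
  k * suc k * t          ≡⟨ eq ⟩
  n * k * suc (n * k)    ≡⟨ cong (_* suc (n * k)) (*-comm n k) ⟩
  k * n * suc (n * k)    ≡⟨ *-assoc k n _ ⟩
  k * (n * suc (n * k))  ∎)
  where open ≡-Reasoning

-- Modulo k + 1 we have k ≡ -1, so n = 2k + 1 ≡ -1 and nk + 1 ≡ 2. The right side is ≡ -2, whence k
-- + 1 divides 2.
odd-order : ∀ k {t} → suc k * t ≡ suc (k + k) * suc (suc (k + k) * k) → k ≤ 1
odd-order k {t} eq = s≤s⁻¹ (∣⇒≤ (∣m+n∣m⇒∣n (divides (4 * (k * k) + 3) (trans
  (cong (_+ 2) eq) (ring k))) (m∣m*n t)))
  where
  ring : ∀ k → suc (k + k) * suc (suc (k + k) * k) + 2 ≡ (4 * (k * k) + 3) * suc k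
  ring = solve-∀

-- Modulo k + 1 we have n = 2k ≡ -2 and nk + 1 ≡ 3, so the right side is ≡ -6 and k + 1 divides 6.
even-order : ∀ k {t} → suc k * t ≡ (k + k) * suc ((k + k) * k) → 3 ≤ k → k ≡ 5
even-order k {t} eq 3≤k = divisor k 3≤k (∣m+n∣m⇒∣n (divides (4 * (k * k) + 6)
  (trans (cong (_+ 6) (trans (*-distribˡ-+ (suc k) t (4 * k)) (cong (_+ suc k * (4 * k)) eq))) (ring k)))
  (m∣m*n (t + 4 * k)))
  where
  -- The multiple 4k (k + 1) is added on both sides to avoid the subtraction in 4k² − 4k + 6.
  ring : ∀ k → (k + k) * suc ((k + k) * k) + suc k * (4 * k) + 6 ≡ (4 * (k * k) + 6) * suc k
  ring = solve-∀
  divisor : ∀ k → 3 ≤ k → suc k ∣ 6 → k ≡ 5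
  divisor 3 _ d = contradiction d (from-no (4 ∣? 6))
  divisor 4 _ d = contradiction d (from-no (5 ∣? 6))
  divisor 5 _ d = refl
  divisor (suc (suc (suc (suc (suc (suc k)))))) _ d with () ← ≤⇒≯ (∣⇒≤ d) (m≤m+n 7 k)
  divisor 1 (s≤s ()) _
  divisor 2 (s≤s (s≤s ())) _

-- The search for n = 10

-- The search represents a weight w by 2 ^ w, so that weights are added by multiplying, and a set of
-- weights by the sum of its members, the mask.  The number zero represents nothing.
taken : ℕ → ℕ → Bool
taken mask zero    = true
taken mask (suc x) = (mask / suc x) % 2 ≡ᵇ 1

-- 2 ^ 85 / x, written out because 2 ^ 85 would be evaluated anew at every call.
complement : ℕ → ℕ
complement zero    = 0
complement (suc x) = 38685626227668133590597632 / suc x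

-- The l-th entry of xs is the arc of length l starting with the label chosen last.  Such an arc is a
-- geodesic if l ≤ 5, and its complement is one if l ≥ 5.
newArcs : List ℕ → List ℕ
newArcs xs = take 5 xs ++ map complement (drop 4 xs)

-- `nothing` reports a clash, that is, a repeated or forbidden weight. This covers an arc heavier
-- than 85: its `complement` is zero, and zero counts as taken.
insertAll : List ℕ → ℕ → Maybe ℕ
insertAll []       mask = just mask
insertAll (x ∷ xs) mask = if taken mask x then nothing else insertAll xs (mask + x)

doublings : ℕ → ℕ → List ℕ
doublings x zero    = []
doublings x (suc n) = x ∷ doublings (2 * x) n

-- Arcs of length 5 have weights between 35 and 50, so a label in front of four labels of sum w is at
-- least 35 − w and at most 50 − w.  The constant is 2 ^ 35.
leastCandidate : ℕ → ℕ
leastCandidate zero    = 2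
leastCandidate (suc w) = (34359738368 / suc w) ⊔ 2

-- Sixteen is the number of weights from 35 to 50. Before four labels are known, the only bound is
-- 50 for a single label.
candidates : List ℕ → List ℕ
candidates (_ ∷ _ ∷ _ ∷ w ∷ _) = doublings (leastCandidate w) 16
candidates _ = doublings 2 50

extend : (List ℕ → ℕ → Bool) → ℕ → List ℕ → Bool
extend next mask xs = maybe′ (next xs) true (insertAll (newArcs xs) mask)

-- The first argument counts the labels still to be chosen; a window that survives to the end makes
-- the result `false`. In `1 ∷ xs` the 1 is the empty arc, which turns into the arc consisting of
-- the new label `x` alone.
refuted : ℕ → List ℕ → ℕ → Bool
refuted zero    xs mask = false
refuted (suc m) xs mask = all (λ x → extend (refuted m) mask (map (x *_) (1 ∷ xs))) (candidates xs)

-- Weight 1 is used by the first label; 0 and 51, …, 100 are never allowed.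
initialMask : ℕ
initialMask = 2 ^ 101 ∸ 2 ^ 51 + 3

-- Binary digits of masks, and coverage of the candidates

bit : ℕ → ℕ → ℕ
bit mask w = (mask / 2 ^ w) % 2
  where instance _ = m^n≢0 2 w

-- `taken` computes only on a visible successor, so `2 ^ w` is generalised to a nonzero `x`.
taken-bit : ∀ mask w → taken mask (2 ^ w) ≡ (bit mask w ≡ᵇ 1)
taken-bit mask w = go (2 ^ w) {{m^n≢0 2 w}}
  where
  go : ∀ x .{{_ : NonZero x}} → taken mask x ≡ ((mask / x) % 2 ≡ᵇ 1)
  go (suc x) = refl

bit-suc : ∀ mask w → bit mask (suc w) ≡ bit (mask / 2) w
bit-suc mask w = cong (_% 2) (sym (m/n/o≡m/[n*o] mask 2 (2 ^ w) {{_}} {{m^n≢0 2 w}} {{m^n≢0 2 (suc w)}}))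

bit-zero : ∀ mask → bit mask 0 ≡ mask % 2
bit-zero mask = cong (_% 2) (n/1≡n mask)

-- Digit `v` is not 1, so the addition produces no carry; the induction strips the lowest digit.
bit-+ : ∀ mask v w → bit mask v ≢ 1 → w ≢ v → bit (mask + 2 ^ v) w ≡ bit mask w
bit-+ mask zero    zero    _ w≢v = contradiction refl w≢v
bit-+ mask zero    (suc w) free _ = begin
  bit (mask + 1) (suc w)    ≡⟨ bit-suc (mask + 1) w ⟩
  bit ((mask + 1) / 2) w    ≡⟨ cong (λ m → bit m w) (+-distrib-/ mask 1 even) ⟩
  bit (mask / 2 + 0) w      ≡⟨ cong (λ m → bit m w) (+-identityʳ (mask / 2)) ⟩
  bit (mask / 2) w          ≡⟨ bit-suc mask w ⟨
  bit mask (suc w)          ∎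
  where
  open ≡-Reasoning
  even : mask % 2 + 1 < 2
  even with mask % 2 | m%n<n mask 2 | free ∘ trans (bit-zero mask)
  ... | 0 | _ | _ = s≤s (s≤s z≤n)
  ... | 1 | _ | odd = contradiction refl odd
  ... | suc (suc _) | s≤s (s≤s ()) | _
bit-+ mask (suc v) zero    _ _ = begin
  bit (mask + 2 * 2 ^ v) 0     ≡⟨ bit-zero (mask + 2 * 2 ^ v) ⟩
  (mask + 2 * 2 ^ v) % 2       ≡⟨ cong (λ m → (mask + m) % 2) (*-comm 2 (2 ^ v)) ⟩
  (mask + 2 ^ v * 2) % 2       ≡⟨ [m+kn]%n≡m%n mask (2 ^ v) 2 ⟩
  mask % 2                     ≡⟨ bit-zero mask ⟨
  bit mask 0                   ∎
  where open ≡-Reasoning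
bit-+ mask (suc v) (suc w) free w≢v = begin
  bit (mask + 2 * 2 ^ v) (suc w)       ≡⟨ bit-suc (mask + 2 * 2 ^ v) w ⟩
  bit ((mask + 2 * 2 ^ v) / 2) w       ≡⟨ cong (λ m → bit m w) half ⟩
  bit (mask / 2 + 2 ^ v) w             ≡⟨ bit-+ (mask / 2) v w (free ∘ trans (bit-suc mask v)) (w≢v ∘ cong suc) ⟩
  bit (mask / 2) w                     ≡⟨ bit-suc mask w ⟨
  bit mask (suc w)                     ∎
  where
  open ≡-Reasoning
  half : (mask + 2 * 2 ^ v) / 2 ≡ mask / 2 + 2 ^ v
  half = trans (cong (λ m → (mask + m) / 2) (*-comm 2 (2 ^ v)))
    (trans (+-distrib-/-∣ʳ mask (divides (2 ^ v) refl)) (cong (mask / 2 +_) (m*n/n≡m (2 ^ v) 2)))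

taken-+ : ∀ mask v w → taken mask (2 ^ v) ≡ false → taken (mask + 2 ^ v) (2 ^ w) ≡ true →
          w ≡ v ⊎ taken mask (2 ^ w) ≡ true
taken-+ mask v w free t with w ≟ v
... | yes w≡v = inj₁ w≡v
... | no  w≢v = inj₂ (begin
    taken mask (2 ^ w)             ≡⟨ taken-bit mask w ⟩
    (bit mask w ≡ᵇ 1)              ≡⟨ cong (_≡ᵇ 1) (bit-+ mask v w bit≢1 w≢v) ⟨
    (bit (mask + 2 ^ v) w ≡ᵇ 1)    ≡⟨ taken-bit (mask + 2 ^ v) w ⟨
    taken (mask + 2 ^ v) (2 ^ w)   ≡⟨ t ⟩
    true                           ∎)
  where
  open ≡-Reasoning
  bit≢1 : bit mask v ≢ 1
  bit≢1 eq with () ← trans (sym free) (trans (taken-bit mask v) (cong (_≡ᵇ 1) eq))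

2^-/ : ∀ {e w y} .{{_ : NonZero y}} → y ≡ 2 ^ w → w ≤ e → 2 ^ e / y ≡ 2 ^ (e ∸ w)
2^-/ {e} {w} refl w≤e = begin
  2 ^ e / 2 ^ w                    ≡⟨ cong (λ x → 2 ^ x / 2 ^ w) (m∸n+n≡m w≤e) ⟨
  2 ^ (e ∸ w + w) / 2 ^ w          ≡⟨ cong (_/ 2 ^ w) (^-distribˡ-+-* 2 (e ∸ w) w) ⟩
  2 ^ (e ∸ w) * 2 ^ w / 2 ^ w      ≡⟨ m*n/n≡m (2 ^ (e ∸ w)) (2 ^ w) ⟩
  2 ^ (e ∸ w)                      ∎
  where open ≡-Reasoning

complement-2^ : ∀ {w} → w ≤ 85 → complement (2 ^ w) ≡ 2 ^ (85 ∸ w)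
complement-2^ {w} w≤85 = go (2 ^ w) {{m^n≢0 2 w}} refl
  where
  go : ∀ y .{{_ : NonZero y}} → y ≡ 2 ^ w → complement y ≡ 2 ^ (85 ∸ w)
  go (suc y) eq = 2^-/ {85} eq w≤85

∈-doublings : ∀ {j n} x → j < n → 2 ^ j * x ∈ doublings x n
∈-doublings {zero}  {suc n} x _ = here (*-identityˡ x)
∈-doublings {suc j} {suc n} x (s≤s j<n) = there (subst (_∈ doublings (2 * x) n) (ring (2 ^ j) x) (∈-doublings (2 * x) j<n))
  where
  ring : ∀ p x → p * (2 * x) ≡ 2 * p * x
  ring = solve-∀

2^∈doublings : ∀ {v e n} → e ≤ v → v < e + n → 2 ^ v ∈ doublings (2 ^ e) n
2^∈doublings {v} {e} {n} e≤v v<e+n = subst (_∈ doublings (2 ^ e) n)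
  (trans (sym (^-distribˡ-+-* 2 (v ∸ e) e)) (cong (2 ^_) (m∸n+n≡m e≤v)))
  (∈-doublings (2 ^ e) (+-cancelˡ-< e _ _ (subst (_< e + n) (sym (m+[n∸m]≡n e≤v)) v<e+n)))

leastCandidate-≤ : ∀ {w} → w ≤ 34 → leastCandidate (2 ^ w) ≡ 2 ^ (35 ∸ w)
leastCandidate-≤ {w} w≤34 = go (2 ^ w) {{m^n≢0 2 w}} refl
  where
  go : ∀ y .{{_ : NonZero y}} → y ≡ 2 ^ w → leastCandidate y ≡ 2 ^ (35 ∸ w)
  go (suc y) eq = trans (cong (_⊔ 2) (2^-/ {35} eq (m≤n⇒m≤1+n w≤34)))
    (m≥n⇒m⊔n≡m (^-monoʳ-≤ 2 (m<n⇒0<n∸m (s≤s w≤34))))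

leastCandidate-≥ : ∀ {w} → 35 ≤ w → leastCandidate (2 ^ w) ≡ 2
leastCandidate-≥ {w} 35≤w = go (2 ^ w) {{m^n≢0 2 w}} (^-monoʳ-≤ 2 35≤w)
  where
  go : ∀ y .{{_ : NonZero y}} → 34359738368 ≤ y → leastCandidate y ≡ 2
  go (suc y) le = m≤n⇒m⊔n≡n (≤-trans (/-monoʳ-≤ 34359738368 {suc y} {34359738368} le) (s≤s z≤n))

∈-doublings-2 : ∀ {v x} n → x ≡ 2 → 1 ≤ v → v ≤ n → 2 ^ v ∈ doublings x n
∈-doublings-2 n refl 1≤v v≤n = 2^∈doublings {e = 1} 1≤v (s≤s v≤n)

-- The variable n keeps the type checker from unfolding the list.
∈-doublings-leastCandidate : ∀ {v w} n {y} → n ≡ 16 → y ≡ 2 ^ w → 1 ≤ v → 35 ≤ v + w → v + w ≤ 50 →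
  2 ^ v ∈ doublings (leastCandidate y) n
∈-doublings-leastCandidate {v} {w} n n≡16 refl 1≤v 35≤v+w v+w≤50 with w ≤? 34
... | yes w≤34 = subst (λ x → 2 ^ v ∈ doublings x n) (sym (leastCandidate-≤ w≤34))
    (2^∈doublings (m≤n+o⇒m∸n≤o 35 w (subst (35 ≤_) (+-comm v w) 35≤v+w))
      (+-cancelʳ-< w v _ (≤-trans (s≤s v+w≤50) (≤-reflexive (sym bound)))))
  where
  bound : 35 ∸ w + n + w ≡ 51
  bound = begin
    35 ∸ w + n + w     ≡⟨ ring (35 ∸ w) n w ⟩
    35 ∸ w + w + n     ≡⟨ cong₂ _+_ (m∸n+n≡m (m≤n⇒m≤1+n w≤34)) n≡16 ⟩
    51                 ∎
    where
    open ≡-Reasoning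
    ring : ∀ a n b → a + n + b ≡ a + b + n
    ring = solve-∀
... | no w≰34 = subst (λ x → 2 ^ v ∈ doublings x n) (sym (leastCandidate-≥ (≰⇒> w≰34)))
    (2^∈doublings {e = 1} 1≤v (≤-trans (+-cancelʳ-≤ w (suc v) 16 (≤-trans (s≤s v+w≤50) (+-monoʳ-≤ 16 (≰⇒> w≰34))))
      (≤-trans (≤-reflexive (sym n≡16)) (n≤1+n n))))

all-true : ∀ {A : Set} (p : A → Bool) {x xs} → all p xs ≡ true → x ∈ xs → p x ≡ true
all-true p {xs = y ∷ ys} eq x∈ with p y in py
all-true p eq (here refl) | true = py
all-true p eq (there x∈)  | true = all-true p eq x∈

unique-ʳ++ : ∀ {A : Set} (xs : List A) {ys} → Unique (xs ʳ++ ys) → Unique ys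
unique-ʳ++ []       u = u
unique-ʳ++ (x ∷ xs) u with unique-ʳ++ xs u
... | _ ∷ u′ = u′

all-ʳ++ : ∀ {A : Set} {P : A → Set} (xs : List A) {ys} → All P (xs ʳ++ ys) → All P ys
all-ʳ++ []       ps = ps
all-ʳ++ (x ∷ xs) ps with all-ʳ++ xs ps
... | _ ∷ ps′ = ps′

-- Soundness of the search

newArcIds : ℕ → ℕ → List (ℕ × ℕ)
newArcIds i r = take 5 ids ++ map (λ (l , i) → 10 ∸ l , i + l) (drop 4 ids)
  where ids = applyUpTo (λ j → suc j , i) r

-- The geodesics recorded once the labels from i on are chosen. Reverse append mirrors the order in
-- which `insertAll` inserts.
arcIds : ℕ → ℕ → List (ℕ × ℕ)
arcIds i zero    = []
arcIds i (suc r) = newArcIds i (suc r) ʳ++ arcIds (suc i) r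

-- The full window yields 9 + 8 + 7 + 6 + 5 geodesics inside it and 5 + 4 + 3 + 2 + 1 as complements
-- of arcs of length 5 to 9: fifty, without repetition.
arcIds-unique : Unique (arcIds 0 9)
arcIds-unique = from-yes (unique? (≡-dec _≟_ _≟_) (arcIds 0 9))

arcIds-range : All (λ (l , i) → 1 ≤ l × l ≤ 5 × i < 10) (arcIds 0 9)
arcIds-range = from-yes (All.all? (λ (l , i) → 1 ≤? l ×-dec l ≤? 5 ×-dec i <? 10) (arcIds 0 9))

initialMask-records : ∀ {w} → w < 51 → 1 ≤ w → taken initialMask (2 ^ w) ≡ true → w ≡ 1
initialMask-records = from-yes
  (allUpTo? (λ w → 1 ≤? w →-dec (taken initialMask (2 ^ w) Bool.≟ true) →-dec w ≟ 1) 51)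

module _ {a : ℕ → ℕ} (leech : IsLeechSequence 10 5 a) (a₈≡1 : a 8 ≡ 1) where
  open IsLeechSequence leech
  open LeechSequence leech

  total≡85 : total ≡ 85
  total≡85 = thirtyfold total total-equation
    where
    thirtyfold : ∀ t → 30 * t ≡ 2550 → t ≡ 85
    thirtyfold t = *-cancelˡ-≡ t 85 30

  arc-complement : ∀ i l → l ≤ 10 → arcSum a i l + arcSum a (i + l) (10 ∸ l) ≡ 85
  arc-complement i l l≤10 = begin
    arcSum a i l + arcSum a (i + l) (10 ∸ l)   ≡⟨ arcSum-split a i l (10 ∸ l) ⟨
    arcSum a i (l + (10 ∸ l))                  ≡⟨ cong (arcSum a i) (m+[n∸m]≡n l≤10) ⟩
    arcSum a i 10                              ≡⟨ arcSum-rotate 10 a periodic i ⟩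
    total                                      ≡⟨ total≡85 ⟩
    85                                         ∎
    where open ≡-Reasoning

  power : ℕ × ℕ → ℕ
  power x = 2 ^ arcWeight x

  complement-power : ∀ {l} i → l ≤ 10 → complement (power (l , i)) ≡ power (10 ∸ l , i + l)
  complement-power {l} i l≤10 = trans
    (complement-2^ (subst (arcSum a i l ≤_) (arc-complement i l l≤10) (m≤m+n _ _)))
    (cong (2 ^_) (trans (cong (_∸ arcSum a i l) (sym (arc-complement i l l≤10))) (m+n∸m≡n (arcSum a i l) _)))

  powers : ℕ → ℕ → List ℕ
  powers i r = applyUpTo (λ j → 2 ^ arcSum a i (suc j)) r

  newArcs-powers : ∀ i r → r ≤ 10 → newArcs (powers i r) ≡ map power (newArcIds i r)
  newArcs-powers i r r≤10 = begin
    newArcs (powers i r)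
      ≡⟨ cong newArcs (map-applyUpTo (λ j → suc j , i) power r) ⟨
    take 5 (map power ids) ++ map complement (drop 4 (map power ids))
      ≡⟨ cong₂ (λ xs ys → xs ++ map complement ys) (take-map 5 ids) (drop-map 4 ids) ⟩
    map power (take 5 ids) ++ map complement (map power (drop 4 ids))
      ≡⟨ cong (map power (take 5 ids) ++_) (trans (sym (map-∘ (drop 4 ids)))
           (trans (map-cong-local (All.drop⁺ 4 (All.applyUpTo⁺₁ _ r λ j<r → complement-power i (≤-trans j<r r≤10))))
             (map-∘ (drop 4 ids)))) ⟩
    map power (take 5 ids) ++ map power (map (λ (l , i) → 10 ∸ l , i + l) (drop 4 ids))
      ≡⟨ map-++ power (take 5 ids) _ ⟨
    map power (newArcIds i r) ∎
    where
    open ≡-Reasoning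
    ids = applyUpTo (λ j → suc j , i) r

  prepend-powers : ∀ i r → map (2 ^ a i *_) (1 ∷ powers (suc i) r) ≡ powers i (suc r)
  prepend-powers i r = cong₂ _∷_ (trans (*-identityʳ (2 ^ a i)) (cong (2 ^_) (sym (+-identityʳ (a i)))))
    (trans (map-applyUpTo _ (2 ^ a i *_) r) (trans (sym (map-upTo _ r)) (trans (map-cong
      (λ j → sym (^-distribˡ-+-* 2 (a i) (arcSum a (suc i) (suc j)))) _) (map-upTo _ r))))

  -- The complement also has five edges, so it weighs at most 50, and 35 = 85 - 50.
  window-≥ : ∀ i → 35 ≤ arcSum a i 5
  window-≥ i = +-cancelʳ-≤ 50 35 _ (subst (_≤ arcSum a i 5 + 50) (arc-complement i 5 (m≤m+n 5 5))
    (+-monoʳ-≤ (arcSum a i 5) (bounded (i + 5) 5 (s≤s z≤n) ≤-refl)))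

  label-≤50 : ∀ i → a i ≤ 50
  label-≤50 i = ≤-trans (≤-reflexive (sym (+-identityʳ (a i)))) (bounded i 1 (s≤s z≤n) (s≤s z≤n))

  a∈candidates : ∀ i r → 2 ^ a i ∈ candidates (powers (suc i) r)
  a∈candidates i 0 = ∈-doublings-2 50 refl (positive i) (label-≤50 i)
  a∈candidates i 1 = ∈-doublings-2 50 refl (positive i) (label-≤50 i)
  a∈candidates i 2 = ∈-doublings-2 50 refl (positive i) (label-≤50 i)
  a∈candidates i 3 = ∈-doublings-2 50 refl (positive i) (label-≤50 i)
  a∈candidates i (suc (suc (suc (suc r)))) =
    ∈-doublings-leastCandidate {a i} {arcSum a (suc i) 4} 16 refl refl
      (positive i) (window-≥ i) (bounded i 5 (s≤s z≤n) ≤-refl)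

  Distinct : List (ℕ × ℕ) → Set
  Distinct xs = Unique xs × All (_∈ arcs) xs

  distinct-ʳ++ : ∀ xs {ys} → Distinct (xs ʳ++ ys) → Distinct ys
  distinct-ʳ++ xs (u , ps) = unique-ʳ++ xs u , all-ʳ++ xs ps

  -- Soundness rests on this inclusion: whatever the mask blocks between 1 and 50 is the weight of a
  -- recorded geodesic.
  Records : ℕ → List (ℕ × ℕ) → Set
  Records mask us = ∀ w → 1 ≤ w → w ≤ 50 → taken mask (2 ^ w) ≡ true → w ∈ map arcWeight us

  arcWeight-range : ∀ {x} → x ∈ arcs → 1 ≤ arcWeight x × arcWeight x ≤ 50
  arcWeight-range x∈arcs with ∈-applyUpTo⁻ suc (∈-resp-↭ (↭-sym weights-↭) (∈-map⁺ arcWeight x∈arcs))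
  ... | _ , w<50 , eq = subst (λ w → 1 ≤ w × w ≤ 50) (sym eq) (s≤s z≤n , w<50)

  -- A blocked weight would be shared with a recorded geodesic, but distinct geodesics have distinct
  -- weights.
  free : ∀ x {us mask} → Distinct (x ∷ us) → Records mask us → taken mask (power x) ≡ false
  free x {mask = mask} (x∉us ∷ _ , x∈arcs ∷ us∈arcs) rec = ¬-not λ t →
    let 1≤wx , wx≤50 = arcWeight-range x∈arcs
        y , y∈us , wx≡wy = ∈-map⁻ arcWeight (rec (arcWeight x) 1≤wx wx≤50 t)
    in All.lookup x∉us y∈us (arcWeight-injective x∈arcs (All.lookup us∈arcs y∈us) wx≡wy)

  records-+ : ∀ x {us mask} → taken mask (power x) ≡ false → Records mask us → Records (mask + power x) (x ∷ us)
  records-+ x {mask = mask} free rec w 1≤w w≤50 t with taken-+ mask (arcWeight x) w free t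
  ... | inj₁ w≡wx = here w≡wx
  ... | inj₂ t′   = there (rec w 1≤w w≤50 t′)

  insertAll-records : ∀ xs {us mask} → Distinct (xs ʳ++ us) → Records mask us →
    ∃[ mask′ ] insertAll (map power xs) mask ≡ just mask′ × Records mask′ (xs ʳ++ us)
  insertAll-records []       {mask = mask} _ rec = mask , refl , rec
  insertAll-records (x ∷ xs) {us} {mask} d rec =
    let x-free = free x (distinct-ʳ++ xs d) rec
        mask′ , eq , rec′ = insertAll-records xs d (records-+ x {mask = mask} x-free rec)
    in mask′ , trans (cong (if_then nothing else insertAll (map power xs) (mask + power x)) x-free) eq , rec′

  arcIds-distinct : ∀ i r → i + r ≡ 9 → Distinct (arcIds i r)
  arcIds-distinct zero    .9 refl = arcIds-unique , All.map (λ (1≤l , l≤5 , i<10) → ∈-arcs 1≤l l≤5 i<10) arcIds-range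
  arcIds-distinct (suc i) r  eq   = distinct-ʳ++ (newArcIds i (suc r)) (arcIds-distinct i (suc r) (trans (+-suc i r) eq))

  -- The actual labels are always among the candidates and never clash, so their branch of the
  -- search reaches depth zero, where the answer is `false`.
  refuted-sound : ∀ i r mask → i + r ≡ 9 → Records mask (arcIds i r) → refuted i (powers i r) mask ≢ true
  refuted-sound zero    r mask _  _   ()
  refuted-sound (suc i) r mask eq rec ref =
    let eq′ = trans (+-suc i r) eq
        mask′ , inserted , rec′ = insertAll-records (newArcIds i (suc r)) (arcIds-distinct i (suc r) eq′) rec
        extended = all-true (λ x → extend (refuted i) mask (map (x *_) (1 ∷ powers (suc i) r))) ref (a∈candidates i r)
    in refuted-sound i (suc r) mask′ eq′ rec′ (begin
      refuted i (powers i (suc r)) mask′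
        ≡⟨ cong (maybe′ (refuted i (powers i (suc r))) true)
             (trans (cong (λ xs → insertAll xs mask)
               (newArcs-powers i (suc r) (m≤n⇒m≤1+n (subst (suc r ≤_) eq′ (m≤n+m (suc r) i))))) inserted) ⟨
      extend (refuted i) mask (powers i (suc r))
        ≡⟨ cong (extend (refuted i) mask) (prepend-powers i r) ⟨
      extend (refuted i) mask (map (2 ^ a i *_) (1 ∷ powers (suc i) r))
        ≡⟨ extended ⟩
      true ∎)
    where open ≡-Reasoning

  initial-records : Records initialMask (arcIds 8 1)
  initial-records w 1≤w w≤50 t = here (trans (initialMask-records (s≤s w≤50) 1≤w t) (sym first-weight))
    where
    first-weight : arcSum a 8 1 ≡ 1
    first-weight = trans (+-identityʳ (a 8)) a₈≡1

  initial-powers : 2 ∷ [] ≡ powers 8 1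
  initial-powers = cong (λ x → 2 ^ x ∷ []) (sym (trans (+-identityʳ (a 8)) a₈≡1))

  -- The variable `xs` carries the result over from `powers 8 1` to the closed list `2 ∷ []`, on
  -- which the search can be evaluated.
  unrefuted : ∀ {xs} → xs ≡ powers 8 1 → refuted 8 xs initialMask ≢ true
  unrefuted refl = refuted-sound 8 1 initialMask refl initial-records

-- The search visits about 110 000 windows.
abstract
  search-refuted : refuted 8 (2 ∷ []) initialMask ≡ true
  search-refuted = refl

-- Excluding every n ≥ 5

arcSum-translate : ∀ a s i l → arcSum (λ j → a (s + j)) i l ≡ arcSum a (s + i) l
arcSum-translate a s i zero    = refl
arcSum-translate a s i (suc l) = cong (a (s + i) +_)
  (trans (arcSum-translate a s (suc i) l) (cong (λ j → arcSum a j l) (+-suc s i)))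

translate : ∀ {n k a} s → IsLeechSequence (suc n) k a → IsLeechSequence (suc n) k (λ i → a (s + i))
translate {n} {k} {a} s leech = record
  { periodic = λ i → trans (cong a (swap-+ s (suc n) i)) (periodic (s + i))
  ; positive = λ i → positive (s + i)
  ; complete = λ w 1≤w w≤nk →
      let i , l , 1≤l , l≤k , eq = complete w 1≤w w≤nk
      -- The order is n + 1, so adding n * s moves back by s and cancels the translation.
      in i + n * s , l , 1≤l , l≤k , (begin
        arcSum (λ j → a (s + j)) (i + n * s) l   ≡⟨ arcSum-translate a s (i + n * s) l ⟩
        arcSum a (s + (i + n * s)) l             ≡⟨ cong (λ j → arcSum a j l) (multiple s i n) ⟩
        arcSum a (i + s * suc n) l               ≡⟨ arcSum-multiple (suc n) a periodic s i l ⟩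
        arcSum a i l                             ≡⟨ eq ⟩
        w                                        ∎)
  ; bounded  = λ i l 1≤l l≤k → subst (_≤ suc n * k) (sym (arcSum-translate a s i l)) (bounded (s + i) l 1≤l l≤k)
  }
  where
  open IsLeechSequence leech
  open ≡-Reasoning
  swap-+ : ∀ s n i → s + (n + i) ≡ n + (s + i)
  swap-+ = solve-∀
  multiple : ∀ s i n → s + (i + n * s) ≡ i + s * suc n
  multiple = solve-∀

label-one : ∀ {n k a} → 1 ≤ n * k → IsLeechSequence n k a → ∃[ i ] a i ≡ 1
label-one {a = a} 1≤nk leech with IsLeechSequence.complete leech 1 ≤-refl 1≤nk
... | i , 1 , _ , _ , eq = i , trans (sym (+-identityʳ (a i))) eq
... | i , suc (suc l) , _ , _ , eq = contradiction (+-mono-≤ (positive i) (≤-trans (positive (suc i)) (m≤m+n _ _)))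
  (<⇒≱ (s≤s (≤-reflexive eq)))
  where open IsLeechSequence leech

no-leechSequence-10 : ∀ {a} → ¬ IsLeechSequence 10 5 a
no-leechSequence-10 {a} leech with label-one (s≤s z≤n) leech
... | p , aₚ≡1 = unrefuted shifted first (initial-powers shifted first) search-refuted
  where
  -- Translating by p + 2 brings the label 1 from position p, equivalently p + 10, to position 8,
  -- the end of the window.
  shifted : IsLeechSequence 10 5 (λ i → a (2 + p + i))
  shifted = translate (2 + p) leech
  first : a (2 + p + 8) ≡ 1
  first = trans (cong a (wrap p)) (trans (IsLeechSequence.periodic leech p) aₚ≡1)
    where
    wrap : ∀ p → 2 + p + 8 ≡ 10 + p
    wrap = solve-∀

no-leechSequence-odd : ∀ {k a} → 2 ≤ k → ¬ IsLeechSequence (suc (k + k)) k a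
no-leechSequence-odd {k} 2≤k leech = contradiction
  (odd-order k {total} (total-equation-cancel (suc (k + k)) k {total} total-equation (≤-trans (s≤s z≤n) 2≤k))) (<⇒≱ 2≤k)
  where open LeechSequence leech

no-leechSequence-even : ∀ {k a} → 3 ≤ k → ¬ IsLeechSequence (k + k) k a
no-leechSequence-even {k@(suc _)} {a} 3≤k leech =
  no-leechSequence-10 (subst (λ j → IsLeechSequence (j + j) j a) k≡5 leech)
  where
  open LeechSequence leech
  k≡5 : k ≡ 5
  k≡5 = even-order k {total} (total-equation-cancel (k + k) k {total} total-equation (≤-trans (s≤s z≤n) 3≤k)) 3≤k

-- Labelings of the triangle and the square

module FromLabels {n k} (n≥3 : n ≥ 3) (2k≤n : k + k ≤ n) (n≤1+2k : n ≤ suc (k + k))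
                  (c : Fin n → ℕ) (c-pos : ∀ u → 1 ≤ c u) where

  open CycleGeodesics n k n≥3 2k≤n n≤1+2k

  -- `c u` labels the edge that leaves `u` clockwise; by `next-asym` an edge has only one clockwise
  -- orientation.
  labeling : EdgeLabeling C
  labeling = record
    { label     = λ { {u} (inj₁ _) → c u ; {_} {v} (inj₂ _) → c v }
    ; label-pos = λ { (inj₁ _) → c-pos _ ; (inj₂ _) → c-pos _ }
    ; label-sym = λ where
        (inj₁ e) (inj₁ e′) → contradiction e′ (next-asym e)
        (inj₁ e) (inj₂ e′) → refl
        (inj₂ e) (inj₁ e′) → refl
        (inj₂ e) (inj₂ e′) → contradiction e′ (next-asym e)
    }

  consecutive? : Dec
    ((∀ i l → arcSum (labels labeling) (toℕ {n} i) (suc (toℕ {k} l)) ≤ n * k) ×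
     (∀ (w : Fin (n * k)) → ∃[ i ] ∃[ l ] arcSum (labels labeling) (toℕ {n} i) (suc (toℕ {k} l)) ≡ suc (toℕ w)))
  consecutive? =
    (Fin.all? λ i → Fin.all? λ l → _ ≤? n * k) ×-dec
    (Fin.all? λ w → Fin.any? λ i → Fin.any? λ l → _ ≟ suc (toℕ w))

  isLeechGraph : True consecutive? → IsGeodesicLeechGraph C
  isLeechGraph consecutive =
    labeling , sequence⇒leech labeling (proj₁ (toWitness consecutive)) (proj₂ (toWitness consecutive))

leech-3 : (n≥3 : 3 ≥ 3) → IsGeodesicLeechGraph (cycle 3 n≥3)
leech-3 n≥3 = FromLabels.isLeechGraph {3} {1} n≥3 (m≤m+n 2 1) ≤-refl (suc ∘ toℕ) (λ _ → s≤s z≤n) _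

-- Cyclically adjacent labels of 6, 2, 3, 1 add up to 8, 5, 4, 7, which completes 1, ..., 8.
leech-4 : (n≥3 : 4 ≥ 3) → IsGeodesicLeechGraph (cycle 4 n≥3)
leech-4 n≥3 = FromLabels.isLeechGraph {4} {2} n≥3 ≤-refl (m≤m+n 4 1) c (from-yes (Fin.all? λ u → 1 ≤? c u)) _
  where
  c : Fin 4 → ℕ
  c = lookup (6 ∷ 2 ∷ 3 ∷ 1 ∷ [])

theorem2p5 : (n : ℕ) (n≥3 : n ≥ 3) →
    (n ≡ 3 ⊎ n ≡ 4 → IsGeodesicLeechGraph (cycle n n≥3)) ×
    (n ≥ 5 → ¬ IsGeodesicLeechGraph (cycle n n≥3))
theorem2p5 n n≥3 = (λ { (inj₁ refl) → leech-3 n≥3 ; (inj₂ refl) → leech-4 n≥3 }) , large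
  where
  large : n ≥ 5 → ¬ IsGeodesicLeechGraph (cycle n n≥3)
  large n≥5 (f , leech) with halve n
  ... | k , inj₁ refl = no-leechSequence-even (≮⇒≥ λ k<3 → <⇒≱ n≥5 (+-mono-≤ (s≤s⁻¹ k<3) (s≤s⁻¹ k<3)))
        (leech⇒sequence f leech)
    where open CycleGeodesics n k n≥3 ≤-refl (n≤1+n _)
  ... | k , inj₂ refl = no-leechSequence-odd (≮⇒≥ λ k<2 → <⇒≱ n≥5
          (s≤s (≤-trans (+-mono-≤ (s≤s⁻¹ k<2) (s≤s⁻¹ k<2)) (s≤s (s≤s z≤n)))))
        (leech⇒sequence f leech)
    where open CycleGeodesics n k n≥3 (n≤1+n _) ≤-refl
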